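{- Let $l=l(n)$ and $n$ be such that $l\to\infty$ and $\ln n/\ln l\to\infty$. Then $$D^{\mathrm{tree}}_0(n,l)\le(1+o(1))\frac{l\ln n}{\ln l}.$$
   Context: First order sentences about (colored) graphs use variables over vertices, connectives, quantifiers, equality, adjacency and unary color predicates (a colored graph carries unary relations; a vertex may have no or several colors). Assume sentences are written so that no quantifier lies within the scope of a negation; the alternation number of a sentence is the maximum, over chains of nested quantifiers, of the number of changes between $\exists$ and $\forall$. $D_r(G)$ is the smallest quantifier depth of a sentence with alternation number at most $r$ which is true in $G$ and false in every (colored) graph not isomorphic to $G$. $D^{\mathrm{tree}}_0(n,l)$ is the maximum of $D_0(T)$ over all colored trees $T$ of order at most $n$ and maximum degree at most $l$. -}

module Defs where

open import Data.Nat using (ℕ; zero; suc; _+_; _*_; _^_; _≤_; _⊔_)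
open import Data.Fin using (Fin; zero; suc; inject₁; fromℕ)
open import Data.Bool using (Bool; true; false; T; if_then_else_)
open import Data.List using (List; map; allFin)
open import Data.Nat.ListAction using (sum)
open import Data.Product using (Σ; _×_; ∃)
open import Relation.Binary.PropositionalEquality using (_≡_)
open import Relation.Nullary using (¬_)
open import Function.Bundles using (_⤖_; Bijection)
open import Function.Definitions using (Injective)

-- Finite (simple, undirected) colored graphs with colors from Fin c.
-- Vertex set Fin N; a vertex may carry no or several colors.

record Graph (c N : ℕ) : Set where
  field
    adj   : Fin N → Fin N → Bool
    sym   : ∀ u v → adj u v ≡ adj v u
    irr   : ∀ v → adj v v ≡ false
    color : Fin N → Fin c → Bool
open Graph public

record Iso {c M N : ℕ} (H : Graph c M) (G : Graph c N) : Set where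
  field
    bij      : Fin M ⤖ Fin N
    pres-adj : ∀ u v → adj H u v ≡ adj G (Bijection.to bij u) (Bijection.to bij v)
    pres-col : ∀ v a → color H v a ≡ color G (Bijection.to bij v) a

data Path {c N : ℕ} (G : Graph c N) : Fin N → Fin N → Set where
  here : ∀ {u} → Path G u u
  step : ∀ {u w v} → T (adj G u w) → Path G w v → Path G u v

Connected : ∀ {c N} → Graph c N → Set
Connected G = ∀ u v → Path G u v

record Cycle {c N : ℕ} (G : Graph c N) : Set where
  field
    k    : ℕ
    vtx  : Fin (3 + k) → Fin N
    inj  : Injective _≡_ _≡_ vtx
    cons : ∀ (i : Fin (2 + k)) → T (adj G (vtx (inject₁ i)) (vtx (suc i)))
    close : T (adj G (vtx (fromℕ (2 + k))) (vtx zero))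

IsTree : ∀ {c N} → Graph c N → Set
IsTree {c} {N} G = (1 ≤ N) × Connected G × ¬ Cycle G

degree : ∀ {c N} → Graph c N → Fin N → ℕ
degree {c} {N} G v = sum (map (λ w → if adj G v w then 1 else 0) (allFin N))

MaxDegreeAtMost : ∀ {c N} → Graph c N → ℕ → Set
MaxDegreeAtMost {c} {N} G l = ∀ v → degree G v ≤ l

-- First-order formulas in negation normal form (no quantifier in the
-- scope of a negation; negation only on atoms).  de Bruijn variables:
-- Fml c k has k free variables.

data Fml (c : ℕ) : ℕ → Set where
  eq neq   : ∀ {k} → Fin k → Fin k → Fml c k
  adjf nadjf : ∀ {k} → Fin k → Fin k → Fml c k
  col ncol : ∀ {k} → Fin c → Fin k → Fml c k
  and or   : ∀ {k} → Fml c k → Fml c k → Fml c k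
  ex all   : ∀ {k} → Fml c (suc k) → Fml c k

Sentence : ℕ → Set
Sentence c = Fml c 0

qd : ∀ {c k} → Fml c k → ℕ
qd (eq _ _) = 0
qd (neq _ _) = 0
qd (adjf _ _) = 0
qd (nadjf _ _) = 0
qd (col _ _) = 0
qd (ncol _ _) = 0
qd (and φ ψ) = qd φ ⊔ qd ψ
qd (or φ ψ) = qd φ ⊔ qd ψ
qd (ex φ) = suc (qd φ)
qd (all φ) = suc (qd φ)

data Qu : Set where
  ∃q ∀q : Qu

chg : Qu → Qu → ℕ
chg ∃q ∃q = 0
chg ∀q ∀q = 0
chg ∃q ∀q = 1
chg ∀q ∃q = 1

altUnder : ∀ {c k} → Qu → Fml c k → ℕ
altUnder q (and φ ψ) = altUnder q φ ⊔ altUnder q ψ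
altUnder q (or φ ψ) = altUnder q φ ⊔ altUnder q ψ
altUnder q (ex φ) = chg q ∃q + altUnder ∃q φ
altUnder q (all φ) = chg q ∀q + altUnder ∀q φ
altUnder q _ = 0

alt : ∀ {c k} → Fml c k → ℕ
alt (and φ ψ) = alt φ ⊔ alt ψ
alt (or φ ψ) = alt φ ⊔ alt ψ
alt (ex φ) = altUnder ∃q φ
alt (all φ) = altUnder ∀q φ
alt _ = 0

extend : ∀ {N k} → Fin N → (Fin k → Fin N) → Fin (suc k) → Fin N
extend v ρ zero = v
extend v ρ (suc i) = ρ i

Sat : ∀ {c N k} → Graph c N → (Fin k → Fin N) → Fml c k → Set
Sat G ρ (eq i j) = ρ i ≡ ρ j
Sat G ρ (neq i j) = ¬ (ρ i ≡ ρ j)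
Sat G ρ (adjf i j) = T (adj G (ρ i) (ρ j))
Sat G ρ (nadjf i j) = ¬ T (adj G (ρ i) (ρ j))
Sat G ρ (col a i) = T (color G (ρ i) a)
Sat G ρ (ncol a i) = ¬ T (color G (ρ i) a)
Sat G ρ (and φ ψ) = Sat G ρ φ × Sat G ρ ψ
Sat G ρ (or φ ψ) = Σ Bool λ b → if b then Sat G ρ φ else Sat G ρ ψ
Sat {N = N} G ρ (ex φ) = Σ (Fin N) λ v → Sat G (extend v ρ) φ
Sat {N = N} G ρ (all φ) = ∀ (v : Fin N) → Sat G (extend v ρ) φ

noVars : ∀ {N} → Fin 0 → Fin N
noVars ()

_⊨_ : ∀ {c N} → Graph c N → Sentence c → Set
G ⊨ φ = Sat G noVars φ

Defines : ∀ {c N} → Sentence c → Graph c N → Set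
Defines {c} φ G = (G ⊨ φ) × (∀ {M} (H : Graph c M) → ¬ Iso H G → ¬ (H ⊨ φ))

{-# OPTIONS --safe #-}

-- A tree of order N is described by an existential sentence that places its
-- vertices recursively. At a vertex, the subtrees hanging off the heavy path
-- are placed in order of decreasing size, so that reaching the i-th one costs
-- i quantifiers and divides the size by i ≤ l; since i / ln i is largest for
-- i = l, this amounts to l ln n / ln l quantifiers. The heavy paths themselves
-- are bisected at weighted medians, at a constant cost per halving.
--
-- The sentence holds in H iff the tree maps to H by a locally injective
-- homomorphism. If moreover no such map misses a vertex of H, and H has no
-- non-backtracking walk on N + 1 vertices (hence no cycle), then H is
-- isomorphic to the tree. Both extra conditions are universal, and they hold
-- in the tree itself.
module Submission where

open import Defs
open import Data.Nat using (ℕ; suc; _+_; _*_; _^_; _≤_)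
open import Data.Product using (Σ; _×_; ∃)
open import Relation.Binary.PropositionalEquality using (_≡_)

open import Data.Bool using (Bool; true; false; T; if_then_else_)
open import Data.Bool.Properties using (T?)
open import Data.Empty using (⊥; ⊥-elim)
import Data.Fin as Fin
open import Data.Fin using (Fin; zero; suc; inject₁; fromℕ)
import Data.Fin.Properties as Finₚ
open import Data.Fin.Relation.Unary.Top using (View; view; ‵inj₁; ‵fromℕ; ‵inject₁; view-fromℕ; view-inject₁)
open import Data.List using (List; []; _∷_; _++_; [_]; map; concatMap; replicate; length; lookup; filter; allFin)
open import Data.List.Membership.Propositional using (_∈_; find)
open import Data.List.Membership.Propositional.Properties
  using (∈-++⁺ˡ; ∈-++⁺ʳ; ∈-++⁻; ∈-∃++; ∈-lookup; ∈-allFin; ∈-filter⁺; ∈-filter⁻; ∈-map⁻)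
open import Data.List.Properties using (map-++; map-∘; length-++; length-map; concatMap-++; ++-identityʳ)
open import Data.List.Relation.Binary.Permutation.Propositional using (_↭_; ↭-sym; ↭⇒↭ₛ)
open import Data.List.Relation.Binary.Permutation.Propositional.Properties
  using (All-resp-↭; ∈-resp-↭; ↭-length)
open import Data.List.Relation.Binary.Permutation.Setoid.Properties using (AllPairs-resp-↭)
open import Data.List.Relation.Binary.Pointwise using (Pointwise; []; _∷_; Pointwise-length)
  renaming (++⁺ to pointwise-++⁺)
open import Data.List.Relation.Unary.All as All using (All; []; _∷_)
import Data.List.Relation.Unary.All.Properties as Allₚ
open import Data.List.Relation.Unary.AllPairs as AllPairs using (AllPairs; []; _∷_)
import Data.List.Relation.Unary.AllPairs.Properties as AllPairsₚ
open import Data.List.Relation.Unary.Any as Any using (here; there)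
open import Data.List.Relation.Unary.Any.Properties using (lookup-index)
open import Data.List.Relation.Unary.Linked using (Linked; [-]; _∷_)
open import Data.List.Relation.Unary.Sorted.TotalOrder.Properties using (Sorted⇒AllPairs)
open import Data.List.Relation.Unary.Unique.Propositional using (Unique)
open import Data.List.Relation.Unary.Unique.Propositional.Properties using (allFin⁺)
open import Data.Nat using (zero; z≤n; s≤s; _<_; _⊔_; NonZero; >-nonZero)
open import Data.Nat.DivMod using (_/_; _%_; m/n*n≤m; m≡m%n+[m/n]*n; m%n<n)
open import Data.Nat.ListAction using (sum)
import Data.Nat.Properties as ℕ
open import Data.Nat.Tactic.RingSolver using (solve-∀)
open import Data.Product using (_,_; proj₁; proj₂; ∃₂; uncurry)
import Data.Sum as Sum
open import Data.Sum using (_⊎_; inj₁; inj₂)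
open import Data.Unit using (⊤; tt)
open import Function using (_∘_; id; _∘′_)
open import Function.Bundles using (mk⤖)
open import Level using (0ℓ)
open import Relation.Binary.Bundles using (DecTotalOrder)
import Relation.Binary.Construct.Flip.EqAndOrd as Flip
import Relation.Binary.Construct.On as On
import Relation.Binary.PropositionalEquality as ≡
open import Relation.Binary.PropositionalEquality using (_≢_; refl; cong; cong₂; subst)
open import Relation.Nullary using (¬_; Dec; yes; no; contradiction)
open import Relation.Nullary.Decidable using (_×-dec_; ¬?)

-- Quantifiers that do not shrink the tree have to be charged to a halving. The critical place is a
-- proper segment of a heavy path: the first subtree hanging off its median may be nearly the whole
-- segment, so entering it gains nothing. Such overheads are kept as additive constants: 5 for a
-- whole heavy path, 7 = 5 + 2 for one of its entries inside a segment, 11 = 7 + 4 for the segment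
-- itself. The halving that cuts out the segment lowers 11 to 5 and also pays for 4 quantifiers; 6 +
-- 4 = 2 + 8 is just what a division by 2 affords once `l ^ (8 * Q) ≤ 2 ^ l`. At the median of the
-- whole path nothing is lost, because the path runs on into the largest subtree, which leaves at
-- most half of the vertices for any other. Without alternation, a universal condition cannot speak
-- about the copy found by the existential part. It speaks about all copies instead, and it is true
-- in the tree itself because a locally injective map from a tree to an acyclic graph is injective.

-- Non-backtracking walks: NB E D a b y z is a walk with first edge a b and
-- last edge y z, in which vertices two steps apart are related by D.
data NB {V : Set} (E D : V → V → Set) : V → V → V → V → Set where
  one  : ∀ {a b} → E a b → NB E D a b a b
  step : ∀ {a b c y z} → E a b → D a c → NB E D b c y z → NB E D a b y z

module _ {V : Set} {E D : V → V → Set} where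

  first-edge : ∀ {a b y z} → NB E D a b y z → E a b
  first-edge (one e)      = e
  first-edge (step e _ _) = e

  infixr 5 _▹_

  -- The walks overlap in a whole edge, not only in a vertex, so every condition on vertices two
  -- steps apart near the junction already belongs to one of them. This is why `NB` records its
  -- first and last edges.
  _▹_ : ∀ {a b y z p q} → NB E D a b y z → NB E D y z p q → NB E D a b p q
  one _      ▹ w = w
  step e d v ▹ w = step e d (v ▹ w)

  module _ (E-sym : ∀ {u v} → E u v → E v u) (D-sym : ∀ {u v} → D u v → D v u) where

    reverse : ∀ {a b y z} → NB E D a b y z → NB E D z y b a
    reverse (one e)      = one (E-sym e)
    reverse (step e d w) = reverse w ▹ step (E-sym (first-edge w)) (D-sym d) (one (E-sym e))

mapNB : ∀ {V V′ : Set} {E D : V → V → Set} {E′ D′ : V′ → V′ → Set} (f : V → V′) →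
        (∀ {u v} → E u v → E′ (f u) (f v)) → (∀ {u v} → D u v → D′ (f u) (f v)) →
        ∀ {a b y z} → NB E D a b y z → NB E′ D′ (f a) (f b) (f y) (f z)
mapNB f e d (one x)      = one (e x)
mapNB f e d (step x y w) = step (e x) (d y) (mapNB f e d w)

-- Plans, their locally injective copies, and walks inside copies

-- A plan describes a rooted tree whose spine (a path starting at the root)
-- is cut recursively into two parts; the subtrees hanging off a spine vertex
-- are plans again.
data Plan (A : Set) : Set where
  at    : A → List (Plan A) → Plan A
  split : Plan A → Plan A → Plan A

module _ {A : Set} where

  labels  : Plan A → List A
  labelss : List (Plan A) → List A
  labels (at a ps)   = a ∷ labelss ps
  labels (split p q) = labels p ++ labels q
  labelss []       = []
  labelss (p ∷ ps) = labels p ++ labelss ps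

  size  : Plan A → ℕ
  sizes : List (Plan A) → ℕ
  size (at a ps)   = suc (sizes ps)
  size (split p q) = size p + size q
  sizes []       = 0
  sizes (p ∷ ps) = size p + sizes ps

  length-labels  : ∀ p → length (labels p) ≡ size p
  length-labelss : ∀ ps → length (labelss ps) ≡ sizes ps
  length-labels (at a ps)   = cong suc (length-labelss ps)
  length-labels (split p q) =
    ≡.trans (length-++ (labels p)) (cong₂ _+_ (length-labels p) (length-labels q))
  length-labelss []       = refl
  length-labelss (p ∷ ps) =
    ≡.trans (length-++ (labels p)) (cong₂ _+_ (length-labels p) (length-labelss ps))

-- Copy p L x y R: a copy of the tree described by p in the structure (V, E),
-- locally injective with respect to D, whose spine runs from x to y; L and R
-- hold the already placed neighbours of x and of y outside of the copy.
module _ {A V : Set} (E D : V → V → Set) (Loc : A → V → Set) where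

  Copy : Plan A → List V → V → V → List V → Set
  Star : List (Plan A) → List V → V → Set
  Copy (at a ps) L x y R =
    x ≡ y × Loc a x × All (λ l → All (D l) R) L × Star ps (L ++ R) x
  Copy (split p q) L x y R =
    ∃₂ λ z z′ → E z z′ × Copy p L x z [ z′ ] × Copy q [ z ] z′ y R
  Star [] F x = ⊤
  Star (p ∷ ps) F x =
    ∃ λ y → E x y × All (D y) F × (∃ λ y′ → Copy p [ x ] y y′ []) × Star ps (y ∷ F) x

module _ {A V : Set} {E D : V → V → Set} {Loc : A → V → Set} where

  vertices  : ∀ p {L x y R} → Copy E D Loc p L x y R → List V
  verticess : ∀ ps {F x} → Star E D Loc ps F x → List V
  vertices (at a ps) {x = x} (_ , _ , _ , s)   = x ∷ verticess ps s
  vertices (split p q) (_ , _ , _ , g , h)     = vertices p g ++ vertices q h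
  verticess [] _                              = []
  verticess (p ∷ ps) (_ , _ , _ , (_ , g) , s) = vertices p g ++ verticess ps s

  labels-vertices : ∀ p {L x y R} (g : Copy E D Loc p L x y R) →
                    Pointwise Loc (labels p) (vertices p g)
  labelss-verticess : ∀ ps {F x} (s : Star E D Loc ps F x) →
                      Pointwise Loc (labelss ps) (verticess ps s)
  labels-vertices (at a ps) (_ , l , _ , s)     = l ∷ labelss-verticess ps s
  labels-vertices (split p q) (_ , _ , _ , g , h) =
    pointwise-++⁺ (labels-vertices p g) (labels-vertices q h)
  labelss-verticess [] _                        = []
  labelss-verticess (p ∷ ps) (_ , _ , _ , (_ , g) , s) =
    pointwise-++⁺ (labels-vertices p g) (labelss-verticess ps s)

  module _ {V′ : Set} {E′ D′ : V′ → V′ → Set} {Loc′ : A → V′ → Set} {P : V → Set} (f : V → V′)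
           (E⇒ : ∀ {u v} → E u v → E′ (f u) (f v)) (D⇒ : ∀ {u v} → D u v → D′ (f u) (f v))
           (Loc⇒ : ∀ {a v} → Loc a v → P v → Loc′ a (f v)) where

    private
      All-D⇒ : ∀ {u xs} → All (D u) xs → All (D′ (f u)) (map f xs)
      All-D⇒ = Allₚ.map⁺ ∘′ All.map D⇒

    mapCopy : ∀ p {L x y R} (g : Copy E D Loc p L x y R) → All P (vertices p g) →
              Copy E′ D′ Loc′ p (map f L) (f x) (f y) (map f R)
    mapStar : ∀ ps {F x} (s : Star E D Loc ps F x) → All P (verticess ps s) →
              Star E′ D′ Loc′ ps (map f F) (f x)
    mapCopy (at a ps) {L} {x} {R = R} (x≡y , l , d , s) (Px ∷ Ps) =
      cong f x≡y , Loc⇒ l Px , Allₚ.map⁺ (All.map All-D⇒ d) ,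
      subst (λ F → Star E′ D′ Loc′ ps F (f x)) (map-++ f L R) (mapStar ps s Ps)
    mapCopy (split p q) (z , z′ , e , g , h) Ps =
      f z , f z′ , E⇒ e , mapCopy p g (Allₚ.++⁻ˡ _ Ps) , mapCopy q h (Allₚ.++⁻ʳ (vertices p g) Ps)
    mapStar [] _ _ = tt
    mapStar (p ∷ ps) (y , e , d , (y′ , g) , s) Ps =
      f y , E⇒ e , All-D⇒ d , (f y′ , mapCopy p g (Allₚ.++⁻ˡ _ Ps)) ,
      mapStar ps s (Allₚ.++⁻ʳ (vertices p g) Ps)

  module _ (E-sym : ∀ {u v} → E u v → E v u) (D-sym : ∀ {u v} → D u v → D v u) where

    private
      Walk : V → V → V → V → Set
      Walk = NB E D

      rev : ∀ {a b y z} → Walk a b y z → Walk z y b a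
      rev = reverse E-sym D-sym

    Joined : V → V → Set
    Joined u v = ∃₂ λ c y → NB E D u c y v

    -- Walks into a copy begin at a placed neighbour outside of it. Of two such walks, one reversed
    -- ends with the edge that the other one begins with, and `_▹_` glues them; `all-joined` obtains
    -- its walks in this way.
    from-left  : ∀ p {L x y R} (g : Copy E D Loc p L x y R) → All (λ l → E l x) L → All (E y) R →
                 ∀ {l u} → l ∈ L → u ∈ vertices p g → ∃ λ t → Walk l x t u
    from-right : ∀ p {L x y R} (g : Copy E D Loc p L x y R) → All (λ l → E l x) L → All (E y) R →
                 ∀ {r u} → r ∈ R → u ∈ vertices p g → ∃ λ t → Walk r y t u
    through    : ∀ p {L x y R} (g : Copy E D Loc p L x y R) → All (λ l → E l x) L → All (E y) R →
                 ∀ {l r} → l ∈ L → r ∈ R → Walk l x y r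
    from-star  : ∀ ps {F x} (s : Star E D Loc ps F x) → All (λ f → E f x) F →
                 ∀ {f u} → f ∈ F → u ∈ verticess ps s → ∃ λ t → Walk f x t u
    from-centre : ∀ ps {F x} (s : Star E D Loc ps F x) → All (λ f → E f x) F →
                  ∀ {u} → u ∈ verticess ps s → Joined x u

    from-left (at a ps) (refl , _ , _ , s) eL eR l∈ (here refl) = _ , one (All.lookup eL l∈)
    from-left (at a ps) (refl , _ , _ , s) eL eR l∈ (there u∈) =
      from-star ps s (Allₚ.++⁺ eL (All.map E-sym eR)) (∈-++⁺ˡ l∈) u∈
    from-left (split p q) (z , z′ , e , g , h) eL eR l∈ u∈ with ∈-++⁻ (vertices p g) u∈
    ... | inj₁ u∈p = from-left p g eL (e ∷ []) l∈ u∈p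
    ... | inj₂ u∈q = let t , w = from-left q h (e ∷ []) eR (here refl) u∈q in
                     t , through p g eL (e ∷ []) l∈ (here refl) ▹ w
    from-right (at a ps) (refl , _ , _ , s) eL eR r∈ (here refl) = _ , one (E-sym (All.lookup eR r∈))
    from-right (at a ps) {L} (refl , _ , _ , s) eL eR r∈ (there u∈) =
      from-star ps s (Allₚ.++⁺ eL (All.map E-sym eR)) (∈-++⁺ʳ L r∈) u∈
    from-right (split p q) (z , z′ , e , g , h) eL eR r∈ u∈ with ∈-++⁻ (vertices p g) u∈
    ... | inj₁ u∈p = let t , w = from-right p g eL (e ∷ []) (here refl) u∈p in
                     t , rev (through q h (e ∷ []) eR (here refl) r∈) ▹ w
    ... | inj₂ u∈q = from-right q h (e ∷ []) eR r∈ u∈q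
    through (at a ps) (refl , _ , d , s) eL eR l∈ r∈ =
      step (All.lookup eL l∈) (All.lookup (All.lookup d l∈) r∈) (one (All.lookup eR r∈))
    through (split p q) (z , z′ , e , g , h) eL eR l∈ r∈ =
      through p g eL (e ∷ []) l∈ (here refl) ▹ through q h (e ∷ []) eR (here refl) r∈
    from-star (p ∷ ps) (y , e , d , (y′ , g) , s) eF f∈ u∈ with ∈-++⁻ (vertices p g) u∈
    ... | inj₁ u∈p = let t , w = from-left p g (e ∷ []) [] (here refl) u∈p in
                     t , step (All.lookup eF f∈) (D-sym (All.lookup d f∈)) w
    ... | inj₂ u∈s = from-star ps s (E-sym e ∷ eF) (there f∈) u∈s
    from-centre (p ∷ ps) (y , e , d , (y′ , g) , s) eF u∈ with ∈-++⁻ (vertices p g) u∈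
    ... | inj₁ u∈p = let t , w = from-left p g (e ∷ []) [] (here refl) u∈p in y , t , w
    ... | inj₂ u∈s = from-centre ps s (E-sym e ∷ eF) u∈s

    -- Local injectivity turns the path between two vertices of the tree into a non-backtracking
    -- walk. In an acyclic graph this makes the copy injective (`vertices-unique`); in a product of
    -- two graphs it lets the coordinates be compared (`product-iso`).
    all-joined  : ∀ p {L x y R} (g : Copy E D Loc p L x y R) → All (λ l → E l x) L → All (E y) R →
                  AllPairs Joined (vertices p g)
    star-joined : ∀ ps {F x} (s : Star E D Loc ps F x) → All (λ f → E f x) F →
                  AllPairs Joined (verticess ps s)
    all-joined (at a ps) (refl , _ , _ , s) eL eR =
      All.tabulate (from-centre ps s eF) ∷ star-joined ps s eF
      where eF = Allₚ.++⁺ eL (All.map E-sym eR)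
    all-joined (split p q) (z , z′ , e , g , h) eL eR =
      AllPairsₚ.++⁺ (all-joined p g eL (e ∷ [])) (all-joined q h (e ∷ []) eR)
        (All.tabulate λ u∈ → All.tabulate λ v∈ →
          _ , _ , rev (proj₂ (from-right p g eL (e ∷ []) (here refl) u∈))
                  ▹ proj₂ (from-left q h (e ∷ []) eR (here refl) v∈))
    star-joined [] _ _ = []
    star-joined (p ∷ ps) (y , e , d , (y′ , g) , s) eF =
      AllPairsₚ.++⁺ (all-joined p g (e ∷ []) []) (star-joined ps s (E-sym e ∷ eF))
        (All.tabulate λ u∈ → All.tabulate λ v∈ →
          _ , _ , rev (proj₂ (from-left p g (e ∷ []) [] (here refl) u∈))
                  ▹ proj₂ (from-star ps s (E-sym e ∷ eF) (here refl) v∈))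

-- Applied to `_≢_`, this demands a difference in both coordinates, which is more than being
-- different pairs. For this reason copies and walks take `D` as a parameter.
_⊗_ : ∀ {V V′ : Set} → (V → V → Set) → (V′ → V′ → Set) → V × V′ → V × V′ → Set
(R ⊗ R′) (u , u′) (v , v′) = R u v × R′ u′ v′

module _ {A V V′ : Set} {E D : V → V → Set} {E′ D′ : V′ → V′ → Set}
         {Loc : A → V → Set} {Loc′ : A → V′ → Set} where

  Both : A → V × V′ → Set
  Both a (u , u′) = Loc a u × Loc′ a u′

  private
    zipD : ∀ {u} xs → All (D (proj₁ u)) (map proj₁ xs) → All (D′ (proj₂ u)) (map proj₂ xs) →
           All ((D ⊗ D′) u) xs
    zipD [] [] []                     = []
    zipD (x ∷ xs) (d ∷ ds) (d′ ∷ ds′) = (d , d′) ∷ zipD xs ds ds′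

  -- The vertices of the zipped copy form the correspondence between the two given copies, from
  -- which the isomorphism is read off.
  zipCopy : ∀ p L {x y x′ y′} R →
            Copy E D Loc p (map proj₁ L) x y (map proj₁ R) →
            Copy E′ D′ Loc′ p (map proj₂ L) x′ y′ (map proj₂ R) →
            Copy (E ⊗ E′) (D ⊗ D′) Both p L (x , x′) (y , y′) R
  zipStar : ∀ ps F {x x′} → Star E D Loc ps (map proj₁ F) x →
            Star E′ D′ Loc′ ps (map proj₂ F) x′ →
            Star (E ⊗ E′) (D ⊗ D′) Both ps F (x , x′)
  zipCopy (at a ps) L {x} {x′ = x′} R (refl , l , d , s) (refl , l′ , d′ , s′) =
    refl , (l , l′) ,
    All.zipWith (λ {u} (ds , ds′) → zipD {u} R ds ds′) (Allₚ.map⁻ d , Allₚ.map⁻ d′) ,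
    zipStar ps (L ++ R)
      (subst (λ F → Star E D Loc ps F x) (≡.sym (map-++ proj₁ L R)) s)
      (subst (λ F → Star E′ D′ Loc′ ps F x′) (≡.sym (map-++ proj₂ L R)) s′)
  zipCopy (split p q) L R (z , t , e , g , h) (z′ , t′ , e′ , g′ , h′) =
    (z , z′) , (t , t′) , (e , e′) ,
    zipCopy p L [ t , t′ ] g g′ , zipCopy q [ z , z′ ] R h h′
  zipStar [] F _ _ = tt
  zipStar (p ∷ ps) F {x} {x′} (y , e , d , (z , g) , s) (y′ , e′ , d′ , (z′ , g′) , s′) =
    (y , y′) , (e , e′) , zipD {y , y′} F d d′ ,
    ((z , z′) , zipCopy p [ x , x′ ] [] g g′) , zipStar ps ((y , y′) ∷ F) s s′

-- Formulas

neg : ∀ {c k} → Fml c k → Fml c k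
neg (eq x y)    = neq x y
neg (neq x y)   = eq x y
neg (adjf x y)  = nadjf x y
neg (nadjf x y) = adjf x y
neg (col a x)   = ncol a x
neg (ncol a x)  = col a x
neg (and φ ψ)   = or (neg φ) (neg ψ)
neg (or φ ψ)    = and (neg φ) (neg ψ)
neg (ex φ)      = all (neg φ)
neg (all φ)     = ex (neg φ)

IsExistential : ∀ {c k} → Fml c k → Set
IsExistential (and φ ψ) = IsExistential φ × IsExistential ψ
IsExistential (or φ ψ)  = IsExistential φ × IsExistential ψ
IsExistential (ex φ)    = IsExistential φ
IsExistential (all φ)   = ⊥
IsExistential _         = ⊤

qd-neg : ∀ {c k} (φ : Fml c k) → qd (neg φ) ≡ qd φ
qd-neg (eq _ _)    = refl
qd-neg (neq _ _)   = refl
qd-neg (adjf _ _)  = refl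
qd-neg (nadjf _ _) = refl
qd-neg (col _ _)   = refl
qd-neg (ncol _ _)  = refl
qd-neg (and φ ψ)   = cong₂ _⊔_ (qd-neg φ) (qd-neg ψ)
qd-neg (or φ ψ)    = cong₂ _⊔_ (qd-neg φ) (qd-neg ψ)
qd-neg (ex φ)      = cong suc (qd-neg φ)
qd-neg (all φ)     = cong suc (qd-neg φ)

altUnder-existential : ∀ {c k} (φ : Fml c k) → IsExistential φ → altUnder ∃q φ ≡ 0
altUnder-existential (eq _ _) _        = refl
altUnder-existential (neq _ _) _       = refl
altUnder-existential (adjf _ _) _      = refl
altUnder-existential (nadjf _ _) _     = refl
altUnder-existential (col _ _) _       = refl
altUnder-existential (ncol _ _) _      = refl
altUnder-existential (and φ ψ) (p , q) = cong₂ _⊔_ (altUnder-existential φ p) (altUnder-existential ψ q)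
altUnder-existential (or φ ψ) (p , q)  = cong₂ _⊔_ (altUnder-existential φ p) (altUnder-existential ψ q)
altUnder-existential (ex φ) p          = altUnder-existential φ p

altUnder-neg : ∀ {c k} (φ : Fml c k) → IsExistential φ → altUnder ∀q (neg φ) ≡ 0
altUnder-neg (eq _ _) _        = refl
altUnder-neg (neq _ _) _       = refl
altUnder-neg (adjf _ _) _      = refl
altUnder-neg (nadjf _ _) _     = refl
altUnder-neg (col _ _) _       = refl
altUnder-neg (ncol _ _) _      = refl
altUnder-neg (and φ ψ) (p , q) = cong₂ _⊔_ (altUnder-neg φ p) (altUnder-neg ψ q)
altUnder-neg (or φ ψ) (p , q)  = cong₂ _⊔_ (altUnder-neg φ p) (altUnder-neg ψ q)
altUnder-neg (ex φ) p          = altUnder-neg φ p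

find-or-all : ∀ {n} {P Q : Fin n → Set} → (∀ i → P i ⊎ Q i) → ∃ P ⊎ (∀ i → Q i)
find-or-all {zero}  _ = inj₂ λ ()
find-or-all {suc n} d with d zero | find-or-all (d ∘ suc)
... | inj₁ p | _            = inj₁ (zero , p)
... | inj₂ _ | inj₁ (i , p) = inj₁ (suc i , p)
... | inj₂ q | inj₂ qs      = inj₂ λ { zero → q ; (suc i) → qs i }

module _ {c N} (G : Graph c N) where

  private
    dec : ∀ {P : Set} → Dec P → P ⊎ ¬ P
    dec (yes p) = inj₁ p
    dec (no ¬p) = inj₂ ¬p

    flip : ∀ {P Q : Set} → P ⊎ Q → Q ⊎ P
    flip (inj₁ p) = inj₂ p
    flip (inj₂ q) = inj₁ q

  -- Atoms are decidable and quantifiers range over a finite set. This is how `holds` passes from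
  -- the refutation of an existential sentence to its dual.
  excluded-middle : ∀ {k} (ρ : Fin k → Fin N) (φ : Fml c k) → Sat G ρ φ ⊎ Sat G ρ (neg φ)
  excluded-middle ρ (eq x y)    = dec (ρ x Finₚ.≟ ρ y)
  excluded-middle ρ (neq x y)   = flip (dec (ρ x Finₚ.≟ ρ y))
  excluded-middle ρ (adjf x y)  = dec (T? _)
  excluded-middle ρ (nadjf x y) = flip (dec (T? _))
  excluded-middle ρ (col a x)   = dec (T? _)
  excluded-middle ρ (ncol a x)  = flip (dec (T? _))
  excluded-middle ρ (and φ ψ) with excluded-middle ρ φ | excluded-middle ρ ψ
  ... | inj₁ p | inj₁ q = inj₁ (p , q)
  ... | inj₁ _ | inj₂ q = inj₂ (false , q)
  ... | inj₂ p | _      = inj₂ (true , p)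
  excluded-middle ρ (or φ ψ) with excluded-middle ρ φ | excluded-middle ρ ψ
  ... | inj₁ p | _      = inj₁ (true , p)
  ... | inj₂ _ | inj₁ q = inj₁ (false , q)
  ... | inj₂ p | inj₂ q = inj₂ (p , q)
  excluded-middle ρ (ex φ)  = find-or-all λ v → excluded-middle (extend v ρ) φ
  excluded-middle ρ (all φ) = flip (find-or-all λ v → flip (excluded-middle (extend v ρ) φ))

  non-contradiction : ∀ {k} (ρ : Fin k → Fin N) (φ : Fml c k) → Sat G ρ (neg φ) → ¬ Sat G ρ φ
  non-contradiction ρ (eq x y)    s t                 = s t
  non-contradiction ρ (neq x y)   s t                 = t s
  non-contradiction ρ (adjf x y)  s t                 = s t
  non-contradiction ρ (nadjf x y) s t                 = t s
  non-contradiction ρ (col a x)   s t                 = s t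
  non-contradiction ρ (ncol a x)  s t                 = t s
  non-contradiction ρ (and φ ψ) (true  , s) (t , _)   = non-contradiction ρ φ s t
  non-contradiction ρ (and φ ψ) (false , s) (_ , t)   = non-contradiction ρ ψ s t
  non-contradiction ρ (or φ ψ) (s , _) (true  , t)    = non-contradiction ρ φ s t
  non-contradiction ρ (or φ ψ) (_ , s) (false , t)    = non-contradiction ρ ψ s t
  non-contradiction ρ (ex φ) s (v , t)                = non-contradiction (extend v ρ) φ (s v) t
  non-contradiction ρ (all φ) (v , s) t               = non-contradiction (extend v ρ) φ s (t v)

Adj : ∀ {c N} → Graph c N → Fin N → Fin N → Set
Adj G u v = T (adj G u v)

-- The variable x only serves to express truth as x = x.
conj : ∀ {c k} → Fin k → List (Fml c k) → Fml c k
conj x []       = eq x x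
conj x (φ ∷ φs) = and φ (conj x φs)

apart : ∀ {c k} → Fin k → List (Fin k) → Fml c k
apart x ys = conj x (map (neq x) ys)

allApart : ∀ {c k} → Fin k → List (Fin k) → List (Fin k) → Fml c k
allApart x ys zs = conj x (map (λ y → apart y zs) ys)

QuantifierFree : ∀ {c k} → Fml c k → Set
QuantifierFree φ = qd φ ≡ 0 × IsExistential φ

conj-quantifierFree : ∀ {c k} (x : Fin k) {φs : List (Fml c k)} → All QuantifierFree φs →
                      QuantifierFree (conj x φs)
conj-quantifierFree x []              = refl , tt
conj-quantifierFree x ((q , e) ∷ φs) =
  let q′ , e′ = conj-quantifierFree x φs in cong₂ _⊔_ q q′ , e , e′

apart-quantifierFree : ∀ {c k} (x : Fin k) ys → QuantifierFree {c} (apart x ys)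
apart-quantifierFree x ys = conj-quantifierFree x (Allₚ.map⁺ (All.universal (λ _ → refl , tt) ys))

allApart-quantifierFree : ∀ {c k} (x : Fin k) ys zs → QuantifierFree {c} (allApart x ys zs)
allApart-quantifierFree x ys zs =
  conj-quantifierFree x (Allₚ.map⁺ (All.universal (λ y → apart-quantifierFree y zs) ys))

module _ {c N} (G : Graph c N) {k} (ρ : Fin k → Fin N) where

  conj-sound : ∀ x φs → Sat G ρ (conj x φs) → All (Sat G ρ) φs
  conj-sound x []       _       = []
  conj-sound x (φ ∷ φs) (s , t) = s ∷ conj-sound x φs t

  conj-complete : ∀ x {φs} → All (Sat G ρ) φs → Sat G ρ (conj x φs)
  conj-complete x []       = refl
  conj-complete x (s ∷ ss) = s , conj-complete x ss

  apart-sound : ∀ x ys → Sat G ρ (apart x ys) → All (ρ x ≢_) (map ρ ys)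
  apart-sound x ys s = Allₚ.map⁺ (Allₚ.map⁻ (conj-sound x (map (neq x) ys) s))

  apart-complete : ∀ x ys → All (ρ x ≢_) (map ρ ys) → Sat G ρ (apart x ys)
  apart-complete x ys d = conj-complete x (Allₚ.map⁺ (Allₚ.map⁻ d))

  map-weaken : ∀ v {xs ys} → map ρ xs ≡ ys → map (extend v ρ) (map suc xs) ≡ ys
  map-weaken v {xs} p = ≡.trans (≡.sym (map-∘ xs)) p

-- The i-th subtree of a star lies under the quantifiers for the first i roots, which have to be
-- kept apart, and under one more that guesses the far end of its spine. A split quantifies the two
-- ends of the edge that it cuts.
cost  : ∀ {A} → Plan A → ℕ
costs : ∀ {A} → List (Plan A) → ℕ
cost (at a ps)   = costs ps
cost (split p q) = 2 + (cost p ⊔ cost q)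
costs []       = 0
costs (p ∷ ps) = suc (suc (cost p) ⊔ costs ps)

module _ {c} {A : Set} (local : ∀ {k} → A → Fin k → Fml c k) where

  private
    ↑ : ∀ {k} → List (Fin k) → List (Fin (suc k))
    ↑ = map suc

  -- The copy has to avoid the vertices denoted by U.
  copyF : ∀ {k} → Plan A → List (Fin k) → Fin k → Fin k → List (Fin k) → List (Fin k) → Fml c k
  starF : ∀ {k} → List (Plan A) → List (Fin k) → Fin k → List (Fin k) → Fml c k
  copyF (at a ps) L x y R U =
    and (eq x y) (and (and (local a x) (apart x U))
      (and (allApart x L R) (starF ps (L ++ R) x U)))
  copyF (split p q) L x y R U =
    ex (ex (and (adjf (suc zero) zero)
      (and (copyF p (↑ (↑ L)) (suc (suc x)) (suc zero) [ zero ] (↑ (↑ U)))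
           (copyF q [ suc zero ] zero (suc (suc y)) (↑ (↑ R)) (↑ (↑ U))))))
  starF [] F x U = eq x x
  starF (p ∷ ps) F x U =
    ex (and (adjf (suc x) zero) (and (apart zero (↑ F))
      (and (ex (copyF p [ suc (suc x) ] (suc zero) zero [] (↑ (↑ U))))
           (starF ps (zero ∷ ↑ F) (suc x) (↑ U)))))

  module _ (local-qf : ∀ {k} a (x : Fin k) → QuantifierFree (local a x)) where

    qd-copyF : ∀ {k} p L (x y : Fin k) R U → qd (copyF p L x y R U) ≡ cost p
    qd-starF : ∀ {k} ps F (x : Fin k) U → qd (starF ps F x U) ≡ costs ps
    qd-copyF (at a ps) L x y R U =
      cong₂ _⊔_ (cong₂ _⊔_ (proj₁ (local-qf a x)) (proj₁ (apart-quantifierFree {c} x U)))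
        (cong₂ _⊔_ (proj₁ (allApart-quantifierFree x L R)) (qd-starF ps (L ++ R) x U))
    qd-copyF (split p q) L x y R U = cong (2 +_) (cong₂ _⊔_
      (qd-copyF p (↑ (↑ L)) (suc (suc x)) (suc zero) [ zero ] (↑ (↑ U)))
      (qd-copyF q [ suc zero ] zero (suc (suc y)) (↑ (↑ R)) (↑ (↑ U))))
    qd-starF [] F x U = refl
    qd-starF {k} (p ∷ ps) F x U =
      cong suc (cong₂ _⊔_ (proj₁ (apart-quantifierFree {c} {suc k} zero (↑ F)))
        (cong₂ _⊔_
          (cong suc (qd-copyF p [ suc (suc x) ] (suc zero) zero [] (↑ (↑ U))))
          (qd-starF ps (zero ∷ ↑ F) (suc x) (↑ U))))

    copyF-existential : ∀ {k} p L (x y : Fin k) R U → IsExistential (copyF p L x y R U)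
    starF-existential : ∀ {k} ps F (x : Fin k) U → IsExistential (starF ps F x U)
    copyF-existential (at a ps) L x y R U =
      tt , (proj₂ (local-qf a x) , proj₂ (apart-quantifierFree {c} x U)) ,
      proj₂ (allApart-quantifierFree x L R) ,
      starF-existential ps (L ++ R) x U
    copyF-existential (split p q) L x y R U =
      tt , copyF-existential p _ _ _ _ _ , copyF-existential q _ _ _ _ _
    starF-existential [] F x U = tt
    starF-existential {k} (p ∷ ps) F x U =
      tt , proj₂ (apart-quantifierFree {c} {suc k} zero (↑ F)) ,
      copyF-existential p _ _ _ _ _ , starF-existential ps _ _ _

  module _ {N} (H : Graph c N) (Loc : A → Fin N → Set) where

    Avoiding : List (Fin N) → A → Fin N → Set
    Avoiding W a v = Loc a v × All (v ≢_) W

    module _ (local-sound : ∀ {k} (ρ : Fin k → Fin N) a x → Sat H ρ (local a x) → Loc a (ρ x)) where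

      -- Lists of variables are tied to their values by equations, since a list shifted under a
      -- quantifier keeps its values only by `map-weaken`, not by computation.
      copyF-sound : ∀ {k} (ρ : Fin k → Fin N) p {L x y R U L′ R′ W} →
        map ρ L ≡ L′ → map ρ R ≡ R′ → map ρ U ≡ W →
        Sat H ρ (copyF p L x y R U) → Copy (Adj H) _≢_ (Avoiding W) p L′ (ρ x) (ρ y) R′
      starF-sound : ∀ {k} (ρ : Fin k → Fin N) ps {F x U F′ W} →
        map ρ F ≡ F′ → map ρ U ≡ W →
        Sat H ρ (starF ps F x U) → Star (Adj H) _≢_ (Avoiding W) ps F′ (ρ x)
      copyF-sound ρ (at a ps) {L} {x} {R = R} {U} refl refl refl (x≡y , (l , u) , d , s) =
        x≡y , (local-sound ρ a x l , apart-sound H ρ x U u) ,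
        Allₚ.map⁺ (All.map (λ {l} → apart-sound H ρ l R) (Allₚ.map⁻ (conj-sound H ρ x _ d))) ,
        starF-sound ρ ps (map-++ ρ L R) refl s
      copyF-sound ρ (split p q) eL eR eU (z , z′ , e , g , h) =
        z , z′ , e ,
        copyF-sound _ p (map-weaken H _ z′ (map-weaken H ρ z eL)) refl (map-weaken H _ z′ (map-weaken H ρ z eU)) g ,
        copyF-sound _ q refl (map-weaken H _ z′ (map-weaken H ρ z eR)) (map-weaken H _ z′ (map-weaken H ρ z eU)) h
      starF-sound ρ [] _ _ _ = tt
      starF-sound ρ (p ∷ ps) {F} eF eU (y , e , d , (y′ , g) , s) =
        y , e , subst (All (y ≢_)) (map-weaken H ρ y eF) (apart-sound H (extend y ρ) zero (↑ F) d) ,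
        (y′ , copyF-sound _ p refl refl (map-weaken H _ y′ (map-weaken H ρ y eU)) g) ,
        starF-sound _ ps (cong (y ∷_) (map-weaken H ρ y eF)) (map-weaken H ρ y eU) s

    module _ (local-complete : ∀ {k} (ρ : Fin k → Fin N) a x → Loc a (ρ x) → Sat H ρ (local a x)) where

      copyF-complete : ∀ {k} (ρ : Fin k → Fin N) p {L x y R U L′ R′ W} →
        map ρ L ≡ L′ → map ρ R ≡ R′ → map ρ U ≡ W →
        Copy (Adj H) _≢_ (Avoiding W) p L′ (ρ x) (ρ y) R′ → Sat H ρ (copyF p L x y R U)
      starF-complete : ∀ {k} (ρ : Fin k → Fin N) ps {F x U F′ W} →
        map ρ F ≡ F′ → map ρ U ≡ W →
        Star (Adj H) _≢_ (Avoiding W) ps F′ (ρ x) → Sat H ρ (starF ps F x U)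
      copyF-complete ρ (at a ps) {L} {x} {R = R} {U} refl refl refl (x≡y , (l , u) , d , s) =
        x≡y , (local-complete ρ a x l , apart-complete H ρ x U u) ,
        conj-complete H ρ x (Allₚ.map⁺ (All.map (λ {l} → apart-complete H ρ l R) (Allₚ.map⁻ d))) ,
        starF-complete ρ ps (map-++ ρ L R) refl s
      copyF-complete ρ (split p q) eL eR eU (z , z′ , e , g , h) =
        z , z′ , e ,
        copyF-complete _ p (map-weaken H _ z′ (map-weaken H ρ z eL)) refl (map-weaken H _ z′ (map-weaken H ρ z eU)) g ,
        copyF-complete _ q refl (map-weaken H _ z′ (map-weaken H ρ z eR)) (map-weaken H _ z′ (map-weaken H ρ z eU)) h
      starF-complete ρ [] _ _ _ = refl
      starF-complete ρ (p ∷ ps) {F} eF eU (y , e , d , (y′ , g) , s) =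
        y , e , apart-complete H (extend y ρ) zero (↑ F) (subst (All (y ≢_)) (≡.sym (map-weaken H ρ y eF)) d) ,
        (y′ , copyF-complete _ p refl refl (map-weaken H _ y′ (map-weaken H ρ y eU)) g) ,
        starF-complete _ ps (cong (y ∷_) (map-weaken H ρ y eF)) (map-weaken H ρ y eU) s

-- Cycles

module _ {A : Set} where

  unique-lookup : ∀ {xs : List A} → Unique xs → ∀ i j → lookup xs i ≡ lookup xs j → i ≡ j
  unique-lookup (_ ∷ _)  zero    zero    _  = refl
  unique-lookup {_ ∷ xs} (x∉ ∷ _) zero (suc j) e = contradiction e (All.lookup x∉ (∈-lookup j))
  unique-lookup {_ ∷ xs} (x∉ ∷ _) (suc i) zero e = contradiction (≡.sym e) (All.lookup x∉ (∈-lookup i))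
  unique-lookup (_ ∷ u)  (suc i) (suc j) e  = cong suc (unique-lookup u i j e)

  unique-prefix : ∀ {a : A} xs {ys} → Unique (xs ++ a ∷ ys) → Unique (a ∷ xs)
  unique-prefix []       _        = [] ∷ []
  unique-prefix (x ∷ xs) (x∉ ∷ u) with unique-prefix xs u | Allₚ.++⁻ʳ xs x∉
  ... | a∉ ∷ v | x≢a ∷ _ = (x≢a ∘ ≡.sym ∷ a∉) ∷ (Allₚ.++⁻ˡ xs x∉ ∷ v)

  linked-lookup : ∀ {E : A → A → Set} x xs {ys} → Linked E (x ∷ xs ++ ys) → ∀ i →
                  E (lookup (x ∷ xs) (inject₁ i)) (lookup xs i)
  linked-lookup x (y ∷ xs) (e ∷ _) zero    = e
  linked-lookup x (y ∷ xs) (_ ∷ l) (suc i) = linked-lookup y xs l i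

  linked-last : ∀ {E : A → A → Set} x xs {a ys} → Linked E (x ∷ xs ++ a ∷ ys) →
                E (lookup (x ∷ xs) (fromℕ (length xs))) a
  linked-last x []       (e ∷ _) = e
  linked-last x (y ∷ xs) (_ ∷ l) = linked-last y xs l

unique-length : ∀ {N} {xs : List (Fin N)} → Unique xs → length xs ≤ N
unique-length u = Finₚ.injective⇒≤ (λ {i} {j} → unique-lookup u i j)

covering-length : ∀ {N} {xs : List (Fin N)} → (∀ v → v ∈ xs) → N ≤ length xs
covering-length {xs = xs} v∈ = Finₚ.injective⇒≤ {f = λ v → Any.index (v∈ v)} λ {u} {v} e →
  ≡.trans (lookup-index (v∈ u)) (≡.trans (cong (lookup xs) e) (≡.sym (lookup-index (v∈ v))))

module _ {V : Set} {E D : V → V → Set} where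

  beyond : ∀ {a b y z} → NB E D a b y z → List V
  beyond (one _)              = []
  beyond (step {c = c} _ _ w) = c ∷ beyond w

  walk-linked : ∀ {a b y z} (w : NB E D a b y z) → Linked E (a ∷ b ∷ beyond w)
  walk-linked (one e)      = e ∷ [-]
  walk-linked (step e _ w) = e ∷ walk-linked w

  last∈walk : ∀ {a b y z} (w : NB E D a b y z) → z ∈ b ∷ beyond w
  last∈walk (one _)      = here refl
  last∈walk (step _ _ w) = there (last∈walk w)

module _ {c N} (G : Graph c N) where

  adj-sym : ∀ {u v} → Adj G u v → Adj G v u
  adj-sym {u} {v} = subst T (Graph.sym G u v)

  adj-irrefl : ∀ {u v} → Adj G u v → u ≢ v
  adj-irrefl {u} e refl = subst T (irr G u) e

  -- If the first vertex a recurs, it does so neither at b (no loops) nor at the vertex after b (no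
  -- backtracking). The vertices before its recurrence are distinct by induction and at least three
  -- in number, so they form a cycle.
  walk-unique : ¬ Cycle G → ∀ {a b y z} (w : NB (Adj G) _≢_ a b y z) → Unique (a ∷ b ∷ beyond w)
  walk-unique _ (one e) = (adj-irrefl e ∷ []) ∷ [] ∷ []
  walk-unique acyclic {a} {b} (step {c = x} e a≢x w) with walk-unique acyclic w | Any.any? (a Finₚ.≟_) (b ∷ x ∷ beyond w)
  ... | u | no a∉                 = Allₚ.¬Any⇒All¬ _ a∉ ∷ u
  ... | u | yes (here refl)         = contradiction refl (adj-irrefl e)
  ... | u | yes (there (here refl)) = contradiction refl a≢x
  ... | u | yes (there (there a∈))  with beyond w | ∈-∃++ a∈ | walk-linked w
  ... | _ | ys , zs , refl | l = ⊥-elim (acyclic record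
    { k     = length ys
    ; vtx   = lookup (a ∷ b ∷ x ∷ ys)
    ; inj   = λ {i} {j} → unique-lookup (unique-prefix (b ∷ x ∷ ys) u) i j
    ; cons  = linked-lookup a (b ∷ x ∷ ys) (e ∷ l)
    ; close = linked-last a (b ∷ x ∷ ys) (e ∷ l)
    })

  walk-ends-differ : ¬ Cycle G → ∀ {a b y z} → NB (Adj G) _≢_ a b y z → a ≢ z
  walk-ends-differ acyclic w with walk-unique acyclic w
  ... | a∉ ∷ _ = All.lookup a∉ (last∈walk w)

  -- An edge from a to z would prolong the walk to a closed non-backtracking walk z, a, b, c, ...,
  -- z.
  no-chord : ¬ Cycle G → ∀ {a b c y z} → Adj G a b → a ≢ c → NB (Adj G) _≢_ b c y z → ¬ Adj G a z
  no-chord acyclic e a≢c w f =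
    walk-ends-differ acyclic (step (adj-sym f) (walk-ends-differ acyclic w ∘ ≡.sym) (step e a≢c w)) refl

-- Spines as lists of entries

module _ {A V : Set} (E D : V → V → Set) (Loc : A → V → Set) where

  -- A copy whose spine is not bracketed yet. `chain⇒copy` turns it into a copy for any bracketing,
  -- so spines can be built entry by entry and cut at medians later.
  Chain : List (A × List (Plan A)) → List V → V → V → List V → Set
  Chain [] L x y R                   = ⊥
  Chain ((a , ps) ∷ []) L x y R      = Copy E D Loc (at a ps) L x y R
  Chain ((a , ps) ∷ e ∷ es) L x y R =
    ∃ λ z → E x z × Copy E D Loc (at a ps) L x x [ z ] × Chain (e ∷ es) [ x ] z y R

spine : ∀ {A} → Plan A → List (A × List (Plan A))
spine (at a ps)   = [ a , ps ]
spine (split p q) = spine p ++ spine q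

NonEmpty : ∀ {A : Set} → List A → Set
NonEmpty xs = ∃₂ λ y ys → xs ≡ y ∷ ys

spine-nonEmpty : ∀ {A} (p : Plan A) → NonEmpty (spine p)
spine-nonEmpty (at a ps) = _ , _ , refl
spine-nonEmpty (split p q) with spine p | spine-nonEmpty p
... | _ | _ , _ , refl = _ , _ , refl

module _ {A V : Set} {E D : V → V → Set} {Loc : A → V → Set} where

  chain-++ : ∀ {es es′ L x y R} → NonEmpty es → NonEmpty es′ → Chain E D Loc (es ++ es′) L x y R →
             ∃₂ λ z z′ → E z z′ × Chain E D Loc es L x z [ z′ ] × Chain E D Loc es′ [ z ] z′ y R
  chain-++ (_ , [] , refl) (_ , _ , refl) (z′ , e , g , h) = _ , z′ , e , g , h
  chain-++ (_ , f ∷ fs , refl) ne′ (t , e , g , h) =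
    let z , z′ , e′ , h₁ , h₂ = chain-++ (f , fs , refl) ne′ h in z , z′ , e′ , (t , e , g , h₁) , h₂

  chain⇒copy : ∀ p {L x y R} → Chain E D Loc (spine p) L x y R → Copy E D Loc p L x y R
  chain⇒copy (at a ps) g = g
  chain⇒copy (split p q) g =
    let z , z′ , e , h₁ , h₂ = chain-++ (spine-nonEmpty p) (spine-nonEmpty q) g in
    z , z′ , e , chain⇒copy p h₁ , chain⇒copy q h₂

-- Walking round a cycle

rotate : ∀ {n} → Fin (suc n) → Fin (suc n)
rotate i with view i
... | ‵fromℕ     = zero
... | ‵inject₁ j = suc j

rotate-fromℕ : ∀ n → rotate (fromℕ n) ≡ zero
rotate-fromℕ n rewrite view-fromℕ n = refl

rotate-inject₁ : ∀ {n} (j : Fin n) → rotate (inject₁ j) ≡ suc j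
rotate-inject₁ j rewrite view-inject₁ j = refl

rotate²-≢ : ∀ {n} (i : Fin (3 + n)) → i ≢ rotate (rotate i)
rotate²-≢ i = by-view (view i)
  where
  by-view : ∀ {n} {i : Fin (3 + n)} → View i → i ≢ rotate (rotate i)
  by-view {n} ‵fromℕ e with ≡.trans e (cong rotate (rotate-fromℕ (2 + n)))
  ... | ()
  by-view {n} (‵inj₁ ‵fromℕ) e
    with ≡.trans e (≡.trans (cong rotate (rotate-inject₁ (fromℕ (suc n)))) (rotate-fromℕ (2 + n)))
  ... | ()
  by-view (‵inj₁ (‵inj₁ {i = j} _)) e =
    ℕ.m≢1+n+m (Fin.toℕ j) {1} (begin
      Fin.toℕ j                                 ≡⟨ Finₚ.toℕ-inject₁ j ⟨
      Fin.toℕ (inject₁ j)                       ≡⟨ Finₚ.toℕ-inject₁ (inject₁ j) ⟨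
      Fin.toℕ (inject₁ (inject₁ j))             ≡⟨ cong Fin.toℕ e ⟩
      Fin.toℕ (rotate (rotate (inject₁ (inject₁ j)))) ≡⟨ cong (Fin.toℕ ∘ rotate) (rotate-inject₁ (inject₁ j)) ⟩
      Fin.toℕ (rotate (suc (inject₁ j)))        ≡⟨ cong Fin.toℕ (rotate-inject₁ (suc j)) ⟩
      suc (suc (Fin.toℕ j))                     ∎)
    where open ≡.≡-Reasoning

pathSpine : ℕ → List (⊤ × List (Plan ⊤))
pathSpine n = replicate (suc n) (tt , [])

module _ {c N} (G : Graph c N) (C : Cycle G) where

  open Cycle C using (vtx; inj; cons; close)

  cycle-edge : ∀ i → Adj G (vtx i) (vtx (rotate i))
  cycle-edge i with view i
  ... | ‵fromℕ     = close
  ... | ‵inject₁ j = cons j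

  -- The walk goes round as often as n demands, so one fixed path length catches cycles of every
  -- length. It never backtracks, because a cycle has at least three vertices (`rotate²-≢`).
  cycle-chain : ∀ {Loc : ⊤ → Fin N → Set} → (∀ v → Loc tt v) →
                ∀ n i L → All (_≢ vtx (rotate i)) L →
                ∃ λ y → Chain (Adj G) _≢_ Loc (pathSpine n) L (vtx i) y []
  cycle-chain loc zero    i L L≢ = vtx i , refl , loc _ , All.universal (λ _ → []) L , tt
  cycle-chain loc (suc n) i L L≢ =
    let y , g = cycle-chain loc n (rotate i) [ vtx i ] ((rotate²-≢ i ∘ inj) ∷ []) in
    y , vtx (rotate i) , cycle-edge i , (refl , loc _ , All.map (_∷ []) L≢ , tt) , g

-- Arithmetic

-- With x = i / l this is (1 + 1/l)^i ≤ 1 + x + x², a bound for e^x on 0 ≤ x ≤ 1 cleared of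
-- fractions. In the inductive step the two sides differ by i (l - i) + l.
suc-power : ∀ l i → i ≤ l → suc l ^ i * (l * l) ≤ l ^ i * (l * l + i * l + i * i)
suc-power l zero    _   = ℕ.≤-reflexive (cong (1 *_) (≡.sym (≡.trans (ℕ.+-identityʳ _) (ℕ.+-identityʳ (l * l)))))
suc-power l (suc i) i<l = begin
  suc l ^ suc i * (l * l)                        ≡⟨ ℕ.*-assoc (suc l) (suc l ^ i) (l * l) ⟩
  suc l * (suc l ^ i * (l * l))                  ≤⟨ ℕ.*-monoʳ-≤ (suc l) (suc-power l i (ℕ.<⇒≤ i<l)) ⟩
  suc l * (l ^ i * (l * l + i * l + i * i))      ≡⟨ exchange (suc l) (l ^ i) _ ⟩
  l ^ i * (suc l * (l * l + i * l + i * i))      ≤⟨ ℕ.*-monoʳ-≤ (l ^ i) (factor (ℕ.m≤n⇒∃[o]m+o≡n (ℕ.<⇒≤ i<l))) ⟩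
  l ^ i * (l * (l * l + suc i * l + suc i * suc i)) ≡⟨ shuffle (l ^ i) l _ ⟩
  l ^ suc i * (l * l + suc i * l + suc i * suc i) ∎
  where
  open ℕ.≤-Reasoning
  exchange : ∀ x y z → x * (y * z) ≡ y * (x * z)
  exchange = solve-∀
  shuffle : ∀ x y z → x * (y * z) ≡ y * x * z
  shuffle = solve-∀
  expand : ∀ i d → (i + d) * ((i + d) * (i + d) + suc i * (i + d) + suc i * suc i)
                   ≡ suc (i + d) * ((i + d) * (i + d) + i * (i + d) + i * i) + (i * d + i + d)
  expand = solve-∀
  factor : ∀ {l} → (∃ λ d → i + d ≡ l) → suc l * (l * l + i * l + i * i) ≤ l * (l * l + suc i * l + suc i * suc i)
  factor (d , refl) = ℕ.≤-trans (ℕ.m≤m+n _ _) (ℕ.≤-reflexive (≡.sym (expand i d)))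

suc-power-≤ : ∀ l i → 1 ≤ l → i ≤ l → suc l ^ i ≤ 3 * l ^ i
suc-power-≤ l@(suc _) i _ i≤l = ℕ.*-cancelʳ-≤ _ _ (l * l) (begin
  suc l ^ i * (l * l)               ≤⟨ suc-power l i i≤l ⟩
  l ^ i * (l * l + i * l + i * i)   ≤⟨ ℕ.*-monoʳ-≤ (l ^ i)
    (ℕ.+-mono-≤ (ℕ.+-monoʳ-≤ (l * l) (ℕ.*-monoˡ-≤ l i≤l)) (ℕ.*-mono-≤ i≤l i≤l)) ⟩
  l ^ i * (l * l + l * l + l * l)   ≡⟨ triple (l ^ i) (l * l) ⟩
  3 * l ^ i * (l * l)               ∎)
  where
  open ℕ.≤-Reasoning
  triple : ∀ x y → x * (y + y + y) ≡ 3 * x * y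
  triple = solve-∀

-- The function x ↦ x / ln x is increasing for x ≥ e, and has the same value at 2 and 4.
power-swap : ∀ i l → 2 ≤ i → i ≤ l → 4 ≤ l → l ^ i ≤ i ^ l
power-swap 2 l _ _ 4≤l with ℕ.m≤n⇒∃[o]m+o≡n 4≤l
... | d , refl = from-four d
  where
  expand : ∀ d → 2 * ((4 + d) * ((4 + d) * 1)) ≡ (5 + d) * ((5 + d) * 1) + (7 + 6 * d + d * d)
  expand = solve-∀
  from-four : ∀ d → (4 + d) ^ 2 ≤ 2 ^ (4 + d)
  from-four zero    = ℕ.≤-refl
  from-four (suc d) = ℕ.≤-trans
    (ℕ.≤-trans (ℕ.m≤m+n _ _) (ℕ.≤-reflexive (≡.sym (expand d)))) (ℕ.*-monoʳ-≤ 2 (from-four d))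
power-swap 1 l (s≤s ()) _ _
power-swap i@(suc (suc (suc j))) l _ i≤l _ with ℕ.m≤n⇒∃[o]m+o≡n i≤l
... | d , refl = subst (λ l → l ^ i ≤ i ^ l) (ℕ.+-comm d i) (from-i d)
  where
  open ℕ.≤-Reasoning
  -- Raising d by one multiplies the left side by at most 3 and the right side by i ≥ 3. So only i =
  -- 2 needs an induction of its own, which starts at 4² = 2⁴.
  from-i : ∀ d → (d + i) ^ i ≤ i ^ (d + i)
  from-i zero    = ℕ.≤-refl
  from-i (suc d) = begin
    suc (d + i) ^ i    ≤⟨ suc-power-≤ (d + i) i (ℕ.≤-trans (s≤s z≤n) (ℕ.m≤n+m i d)) (ℕ.m≤n+m i d) ⟩
    3 * (d + i) ^ i    ≤⟨ ℕ.*-mono-≤ (s≤s (s≤s (s≤s (z≤n {j})))) (from-i d) ⟩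
    i * i ^ (d + i)    ∎

n<2^n : ∀ n → n < 2 ^ n
n<2^n zero    = s≤s z≤n
n<2^n (suc n) = ℕ.+-mono-≤ (ℕ.m^n>0 2 n) (ℕ.≤-trans (n<2^n n) (ℕ.m≤m+n (2 ^ n) 0))

power≤exponential : ∀ K → ∃ λ l₀ → ∀ l → l₀ ≤ l → l ^ K ≤ 2 ^ l
power≤exponential zero      = 0 , λ l _ → ℕ.m^n>0 2 l
power≤exponential K@(suc _) = 4 * (K * K) , λ l l₀≤l →
  let open ℕ.≤-Reasoning
      -- The proof uses l ≤ 2K (m + 1) ≤ 2^(2K + m). In the exponent K (2K + m) both 2K² and Km are
      -- at most l / 2, the former since l ≥ 4K², the latter by the choice of m.
      m = l / (2 * K)
      exponent : (2 * K + m) * K ≤ l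
      exponent = ℕ.*-cancelˡ-≤ 2 (begin
        2 * ((2 * K + m) * K)            ≡⟨ double K m ⟩
        4 * (K * K) + m * (2 * K)        ≤⟨ ℕ.+-mono-≤ l₀≤l (m/n*n≤m l (2 * K)) ⟩
        l + l                            ≡⟨ cong (l +_) (ℕ.+-identityʳ l) ⟨
        2 * l                            ∎)
      base : l ≤ 2 ^ (2 * K + m)
      base = begin
        l                                ≡⟨ m≡m%n+[m/n]*n l (2 * K) ⟩
        l % (2 * K) + m * (2 * K)        ≤⟨ ℕ.+-monoˡ-≤ _ (ℕ.<⇒≤ (m%n<n l (2 * K))) ⟩
        suc m * (2 * K)                  ≤⟨ ℕ.*-mono-≤ (n<2^n m) (ℕ.<⇒≤ (n<2^n (2 * K))) ⟩
        2 ^ m * 2 ^ (2 * K)              ≡⟨ ℕ.*-comm (2 ^ m) _ ⟩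
        2 ^ (2 * K) * 2 ^ m              ≡⟨ ℕ.^-distribˡ-+-* 2 (2 * K) m ⟨
        2 ^ (2 * K + m)                  ∎
  in begin
    l ^ K                ≤⟨ ℕ.^-monoˡ-≤ K base ⟩
    (2 ^ (2 * K + m)) ^ K ≡⟨ ℕ.^-*-assoc 2 (2 * K + m) K ⟩
    2 ^ ((2 * K + m) * K) ≤⟨ ℕ.^-monoʳ-≤ 2 exponent ⟩
    2 ^ l                ∎
  where
  double : ∀ K m → 2 * ((2 * K + m) * K) ≡ 4 * (K * K) + m * (2 * K)
  double = solve-∀

*-power : ∀ m n k → (m * n) ^ k ≡ m ^ k * n ^ k
*-power m n zero    = refl
*-power m n (suc k) = ≡.trans (cong (m * n *_) (*-power m n k)) (interchange m n (m ^ k) (n ^ k))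
  where
  interchange : ∀ a b c d → a * b * (c * d) ≡ a * c * (b * d)
  interchange = solve-∀

-- Costs of plans

weight : ∀ {A : Set} → A × List (Plan A) → ℕ
weight (_ , ps) = suc (sizes ps)

total : ∀ {A : Set} → List (A × List (Plan A)) → ℕ
total []       = 0
total (e ∷ es) = weight e + total es

total-++ : ∀ {A : Set} (es es′ : List (A × List (Plan A))) → total (es ++ es′) ≡ total es + total es′
total-++ []       es′ = refl
total-++ (e ∷ es) es′ = ≡.trans (cong (weight e +_) (total-++ es es′)) (≡.sym (ℕ.+-assoc (weight e) _ _))

total-spine : ∀ {A : Set} (p : Plan A) → total (spine p) ≡ size p
total-spine (at a ps)   = ℕ.+-identityʳ _
total-spine (split p q) = ≡.trans (total-++ (spine p) (spine q)) (cong₂ _+_ (total-spine p) (total-spine q))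

1≤size : ∀ {A : Set} (p : Plan A) → 1 ≤ size p
1≤size (at a ps)   = s≤s z≤n
1≤size (split p q) = ℕ.≤-trans (1≤size p) (ℕ.m≤m+n _ _)

-- The scan stops at the first entry after which at most half of the weight remains. As long as more
-- than half remains, everything up to and including the current entry weighs at most half.
weighted-median : ∀ {A : Set} {S} acc (es : List (A × List (Plan A))) → NonEmpty es → S ≡ acc + total es → 2 * acc ≤ S →
  ∃ λ ls → ∃₂ λ e rs → es ≡ ls ++ e ∷ rs × 2 * (acc + total ls) ≤ S × 2 * total rs ≤ S
weighted-median {S = S} acc (e ∷ rs) _ S≡ acc≤ with 2 * total rs ℕ.≤? S
... | yes rs≤ = [] , e , rs , refl , subst (λ a → 2 * a ≤ S) (≡.sym (ℕ.+-identityʳ acc)) acc≤ , rs≤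
weighted-median acc (e ∷ []) _ S≡ acc≤ | no rs≰ = contradiction z≤n rs≰
weighted-median {S = S} acc (e ∷ rs@(f ∷ fs)) _ S≡ acc≤ | no rs≰ =
  let ls , g , rs′ , rs≡ , ls≤ , rs′≤ = weighted-median (acc + weight e) rs (f , fs , refl) S≡′ acc≤′ in
  e ∷ ls , g , rs′ , cong (e ∷_) rs≡ ,
  subst (λ a → 2 * a ≤ S) (ℕ.+-assoc acc (weight e) (total ls)) ls≤ , rs′≤
  where
  S≡′ : S ≡ acc + weight e + total rs
  S≡′ = ≡.trans S≡ (≡.sym (ℕ.+-assoc acc _ _))
  double : ∀ a b → 2 * a + 2 * b ≡ (a + b) + (a + b)
  double = solve-∀
  acc≤′ : 2 * (acc + weight e) ≤ S
  acc≤′ = ℕ.+-cancelʳ-≤ (2 * total rs) _ _ (begin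
    2 * (acc + weight e) + 2 * total rs ≡⟨ double (acc + weight e) (total rs) ⟩
    (acc + weight e + total rs) + (acc + weight e + total rs) ≡⟨ cong₂ _+_ S≡′ S≡′ ⟨
    S + S                               ≤⟨ ℕ.+-monoʳ-≤ S (ℕ.<⇒≤ (ℕ.≰⇒> rs≰)) ⟩
    S + 2 * total rs                    ∎)
    where open ℕ.≤-Reasoning

module Budget (l Q : ℕ) (4≤l : 4 ≤ l) (slack : l ^ (8 * Q) ≤ 2 ^ l) where

  instance
    l≢0 : NonZero l
    l≢0 = >-nonZero (ℕ.≤-trans (s≤s z≤n) 4≤l)

  -- Up to the additive constant c, the cost t is at most (1 + 1/Q) l ln s / ln l.
  _⊢_◃_ : ℕ → ℕ → ℕ → Set
  c ⊢ t ◃ s = l ^ (Q * t) ≤ l ^ (Q * c) * s ^ (suc Q * l)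

  ◃-monoˡ : ∀ {c t t′ s} → t ≤ t′ → c ⊢ t′ ◃ s → c ⊢ t ◃ s
  ◃-monoˡ t≤ h = ℕ.≤-trans (ℕ.^-monoʳ-≤ l (ℕ.*-monoʳ-≤ Q t≤)) h

  ◃-monoʳ : ∀ {c t s s′} → s ≤ s′ → c ⊢ t ◃ s → c ⊢ t ◃ s′
  ◃-monoʳ {c} s≤ h = ℕ.≤-trans h (ℕ.*-monoʳ-≤ (l ^ (Q * c)) (ℕ.^-monoˡ-≤ (suc Q * l) s≤))

  ◃-weaken : ∀ {c c′ t s} → c ≤ c′ → c ⊢ t ◃ s → c′ ⊢ t ◃ s
  ◃-weaken {s = s} c≤ h = ℕ.≤-trans h (ℕ.*-monoˡ-≤ (s ^ (suc Q * l)) (ℕ.^-monoʳ-≤ l (ℕ.*-monoʳ-≤ Q c≤)))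

  ◃-base : ∀ {c t s} → t ≤ c → 1 ≤ s → c ⊢ t ◃ s
  ◃-base {c} {t} {s} t≤c 1≤s = begin
    l ^ (Q * t)                     ≤⟨ ℕ.^-monoʳ-≤ l (ℕ.*-monoʳ-≤ Q t≤c) ⟩
    l ^ (Q * c)                     ≤⟨ ℕ.m≤m*n _ _ ⟩
    l ^ (Q * c) * s ^ (suc Q * l)   ∎
    where
    open ℕ.≤-Reasoning
    instance
      s≢0 : NonZero s
      s≢0 = >-nonZero 1≤s
      pow≢0 : NonZero (s ^ (suc Q * l))
      pow≢0 = ℕ.m^n≢0 s (suc Q * l)

  ◃-⊔ : ∀ {c a b s} d → c ⊢ d + a ◃ s → c ⊢ d + b ◃ s → c ⊢ d + (a ⊔ b) ◃ s
  ◃-⊔ {c} {a} {b} {s} d h h′ with ℕ.⊔-sel a b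
  ... | inj₁ e = subst (λ t → c ⊢ d + t ◃ s) (≡.sym e) h
  ... | inj₂ e = subst (λ t → c ⊢ d + t ◃ s) (≡.sym e) h′

  private
    power-+ : ∀ a b → l ^ (Q * (a + b)) ≡ l ^ (Q * a) * l ^ (Q * b)
    power-+ a b = ≡.trans (cong (l ^_) (ℕ.*-distribˡ-+ Q a b)) (ℕ.^-distribˡ-+-* l (Q * a) (Q * b))

  ◃-shift : ∀ {c t s} d → c ⊢ t ◃ s → (d + c) ⊢ d + t ◃ s
  ◃-shift {c} {t} {s} d h = begin
    l ^ (Q * (d + t))                               ≡⟨ power-+ d t ⟩
    l ^ (Q * d) * l ^ (Q * t)                       ≤⟨ ℕ.*-monoʳ-≤ (l ^ (Q * d)) h ⟩
    l ^ (Q * d) * (l ^ (Q * c) * s ^ (suc Q * l))   ≡⟨ ℕ.*-assoc (l ^ (Q * d)) _ _ ⟨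
    l ^ (Q * d) * l ^ (Q * c) * s ^ (suc Q * l)     ≡⟨ cong (_* s ^ (suc Q * l)) (power-+ d c) ⟨
    l ^ (Q * (d + c)) * s ^ (suc Q * l)             ∎
    where open ℕ.≤-Reasoning

  -- Of the Q + 1 factors i ^ l, Q pay for i quantifiers by `power-swap`, and the last one, being at
  -- least 2 ^ l, pays for 8 more by `slack`.
  slack-power : ∀ {i t} → 2 ≤ i → i ≤ l → t ≤ i + 8 → l ^ (Q * t) ≤ i ^ (suc Q * l)
  slack-power {i} {t} 2≤i i≤l t≤ = begin
    l ^ (Q * t)                ≤⟨ ℕ.^-monoʳ-≤ l (ℕ.*-monoʳ-≤ Q t≤) ⟩
    l ^ (Q * (i + 8))          ≡⟨ power-+ i 8 ⟩
    l ^ (Q * i) * l ^ (Q * 8)  ≡⟨ cong₂ (λ a b → l ^ a * l ^ b) (ℕ.*-comm Q i) (ℕ.*-comm Q 8) ⟩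
    l ^ (i * Q) * l ^ (8 * Q)  ≡⟨ cong (_* l ^ (8 * Q)) (ℕ.^-*-assoc l i Q) ⟨
    (l ^ i) ^ Q * l ^ (8 * Q)  ≤⟨ ℕ.*-mono-≤
      (ℕ.^-monoˡ-≤ Q (power-swap i l 2≤i i≤l 4≤l)) (ℕ.≤-trans slack (ℕ.^-monoˡ-≤ l 2≤i)) ⟩
    (i ^ l) ^ Q * i ^ l        ≡⟨ cong (_* i ^ l) (ℕ.^-*-assoc i l Q) ⟩
    i ^ (l * Q) * i ^ l        ≡⟨ ℕ.*-comm (i ^ (l * Q)) (i ^ l) ⟩
    i ^ l * i ^ (l * Q)        ≡⟨ ℕ.^-distribˡ-+-* i l (l * Q) ⟨
    i ^ (l + l * Q)            ≡⟨ cong (λ a → i ^ (l + a)) (ℕ.*-comm l Q) ⟩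
    i ^ (suc Q * l)            ∎
    where open ℕ.≤-Reasoning

  -- The i + 8 quantifiers gained by dividing the size by i are shared: j are spent at once, and e
  -- serve to lower the additive constant.
  ◃-step : ∀ {c t s s′} e j i → 2 ≤ i → i ≤ l → i * s′ ≤ s → e + j ≤ i + 8 →
           (e + c) ⊢ t ◃ s′ → c ⊢ j + t ◃ s
  ◃-step {c} {t} {s} {s′} e j i 2≤i i≤l is′≤s ej≤ h = begin
    l ^ (Q * (j + t))                                   ≡⟨ power-+ j t ⟩
    l ^ (Q * j) * l ^ (Q * t)                           ≤⟨ ℕ.*-monoʳ-≤ (l ^ (Q * j)) h ⟩
    l ^ (Q * j) * (l ^ (Q * (e + c)) * s′ ^ P)          ≡⟨ cong (λ a → l ^ (Q * j) * (a * s′ ^ P)) (power-+ e c) ⟩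
    l ^ (Q * j) * (l ^ (Q * e) * l ^ (Q * c) * s′ ^ P)  ≡⟨ regroup (l ^ (Q * j)) (l ^ (Q * e)) (l ^ (Q * c)) (s′ ^ P) ⟩
    l ^ (Q * e) * l ^ (Q * j) * (l ^ (Q * c) * s′ ^ P)  ≡⟨ cong (_* (l ^ (Q * c) * s′ ^ P)) (power-+ e j) ⟨
    l ^ (Q * (e + j)) * (l ^ (Q * c) * s′ ^ P)          ≤⟨ ℕ.*-monoˡ-≤ _ (slack-power 2≤i i≤l ej≤) ⟩
    i ^ P * (l ^ (Q * c) * s′ ^ P)                      ≡⟨ exchange (i ^ P) (l ^ (Q * c)) (s′ ^ P) ⟩
    l ^ (Q * c) * (i ^ P * s′ ^ P)                      ≡⟨ cong (l ^ (Q * c) *_) (*-power i s′ P) ⟨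
    l ^ (Q * c) * (i * s′) ^ P                          ≤⟨ ℕ.*-monoʳ-≤ (l ^ (Q * c)) (ℕ.^-monoˡ-≤ P is′≤s) ⟩
    l ^ (Q * c) * s ^ P                                 ∎
    where
    open ℕ.≤-Reasoning
    P = suc Q * l
    regroup : ∀ a b x y → a * (b * x * y) ≡ b * a * (x * y)
    regroup = solve-∀
    exchange : ∀ a b x → a * (b * x) ≡ b * (a * x)
    exchange = solve-∀

  -- The constant is 5 for the plan plus 3 for the outermost quantifiers of the sentence about
  -- missed vertices, and 2n makes room for the path on N + 1 vertices. Together they contribute at
  -- most 2 ^ ((2 + Q) * l), hence one more factor n ^ l.
  ◃-conclude : ∀ {d n} → 2 ^ (2 + Q) ≤ n → 8 ⊢ d ◃ (2 * n) → l ^ (Q * d) ≤ n ^ ((2 + Q) * l)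
  ◃-conclude {d} {n} 2^≤n h = begin
    l ^ (Q * d)                      ≤⟨ h ⟩
    l ^ (Q * 8) * (2 * n) ^ P        ≡⟨ cong₂ (λ a b → l ^ a * b) (ℕ.*-comm Q 8) (*-power 2 n P) ⟩
    l ^ (8 * Q) * (2 ^ P * n ^ P)    ≡⟨ ℕ.*-assoc (l ^ (8 * Q)) _ _ ⟨
    l ^ (8 * Q) * 2 ^ P * n ^ P      ≤⟨ ℕ.*-monoˡ-≤ (n ^ P) (ℕ.*-monoˡ-≤ (2 ^ P) slack) ⟩
    2 ^ l * 2 ^ P * n ^ P            ≡⟨ cong (_* n ^ P) (ℕ.^-distribˡ-+-* 2 l P) ⟨
    2 ^ ((2 + Q) * l) * n ^ P        ≡⟨ cong (_* n ^ P) (ℕ.^-*-assoc 2 (2 + Q) l) ⟨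
    (2 ^ (2 + Q)) ^ l * n ^ P        ≤⟨ ℕ.*-monoˡ-≤ (n ^ P) (ℕ.^-monoˡ-≤ l 2^≤n) ⟩
    n ^ l * n ^ P                    ≡⟨ ℕ.^-distribˡ-+-* n l P ⟨
    n ^ ((2 + Q) * l)                ∎
    where
    open ℕ.≤-Reasoning
    P = suc Q * l

  -- Bounds for spine entries and the balancing of spines

  module _ {A : Set} where

    Descending : List (Plan A) → Set
    Descending = AllPairs (λ p q → size q ≤ size p)

    -- The m subtrees preceding ps weigh acc together, and each of them at
    -- least as much as any member of ps; hence the i-th subtree in the whole
    -- list has at most S / i vertices.
    costs-◃ : ∀ {c S} j m acc ps → suc j ≤ c → j ≤ 5 → 1 ≤ m → m + length ps ≤ l → m ≤ acc →
              acc + sizes ps ≤ S → All (λ p → m * size p ≤ acc) ps → Descending ps →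
              All (λ p → c ⊢ cost p ◃ size p) ps → c ⊢ (j + m) + costs ps ◃ S
    -- For m = 1 there is nothing to divide by, and the constant c pays for the j + 1 quantifiers.
    -- For m ≥ 2 the preceding subtrees have at least m vertices, so dividing S by m pays.
    costs-◃ {c} {S} j 1 acc [] j<c _ _ _ m≤ acc≤ _ _ _ =
      subst (λ t → c ⊢ t ◃ S) (≡.sym (≡.trans (ℕ.+-identityʳ (j + 1)) (ℕ.+-comm j 1)))
        (◃-base j<c (ℕ.≤-trans m≤ (ℕ.≤-trans (ℕ.m≤m+n acc _) acc≤)))
    costs-◃ j m@(suc (suc k)) acc [] j<c j≤5 _ m≤l m≤ acc≤ _ _ _ =
      ◃-step 0 (j + m) m (s≤s (s≤s z≤n)) (ℕ.≤-trans (ℕ.m≤m+n m 0) m≤l)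
        (ℕ.≤-trans (ℕ.≤-reflexive (ℕ.*-identityʳ m)) (ℕ.≤-trans m≤ (ℕ.≤-trans (ℕ.m≤m+n acc _) acc≤)))
        (ℕ.≤-trans (ℕ.≤-reflexive (ℕ.+-comm j m)) (ℕ.+-monoʳ-≤ m (ℕ.≤-trans j≤5 (ℕ.m≤m+n 5 3))))
        (◃-base z≤n ℕ.≤-refl)
    costs-◃ {c} {S} j m acc (p ∷ ps) j<c j≤5 1≤m m≤l m≤ acc≤ (mp≤ ∷ mps≤) (p≥ ∷ desc) (h ∷ hs) =
      ◃-⊔ (j + m) first (subst (λ t → c ⊢ t ◃ S) shift rest)
      where
      sm≤l : suc m + length ps ≤ l
      sm≤l = subst (_≤ l) (ℕ.+-suc m (length ps)) m≤l
      first : c ⊢ (j + m) + (2 + cost p) ◃ S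
      first = subst (λ t → c ⊢ t ◃ S) (ℕ.+-assoc (j + m) 2 (cost p))
        (◃-step 0 (j + m + 2) (suc m) (s≤s 1≤m) (ℕ.≤-trans (ℕ.m≤m+n (suc m) _) sm≤l)
          (ℕ.≤-trans (ℕ.+-monoʳ-≤ (size p) mp≤)
            (ℕ.≤-trans (ℕ.≤-reflexive (ℕ.+-comm (size p) acc))
              (ℕ.≤-trans (ℕ.+-monoʳ-≤ acc (ℕ.m≤m+n (size p) (sizes ps))) acc≤)))
          (ℕ.≤-trans (ℕ.≤-reflexive (move j m)) (ℕ.+-monoʳ-≤ (suc m) (ℕ.≤-trans (ℕ.+-monoˡ-≤ 1 j≤5) (ℕ.m≤m+n 6 2))))
          h)
        where
        move : ∀ j m → j + m + 2 ≡ suc m + (j + 1)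
        move = solve-∀
      rest : c ⊢ (j + suc m) + costs ps ◃ S
      rest = costs-◃ j (suc m) (size p + acc) ps j<c j≤5 (s≤s z≤n) sm≤l
        (ℕ.+-mono-≤ (1≤size p) m≤)
        (ℕ.≤-trans (ℕ.≤-reflexive (≡.trans (cong (_+ sizes ps) (ℕ.+-comm (size p) acc)) (ℕ.+-assoc acc (size p) _))) acc≤)
        (All.zipWith (λ (q≤p , mq≤) → ℕ.+-mono-≤ q≤p mq≤) (p≥ , mps≤)) desc hs
      shift : (j + suc m) + costs ps ≡ (j + m) + suc (costs ps)
      shift = ≡.trans (cong (_+ costs ps) (ℕ.+-suc j m)) (≡.sym (ℕ.+-suc (j + m) (costs ps)))

    -- The two bounds required of an entry of a spine: the first one suffices
    -- inside of a proper segment of the spine, and the second one uses that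
    -- the spine of weight S continues into the largest subtree.
    Local : A × List (Plan A) → Set
    Local (a , ps) = 7 ⊢ costs ps ◃ weight (a , ps)

    Light : ℕ → A × List (Plan A) → Set
    Light S (_ , ps) = 5 ⊢ 4 + costs ps ◃ S

    -- The first subtree may be almost as large as the weight of the entry, so its 2 quantifiers go
    -- into the constant, 5 + 2 = 7. The others are measured against it by `costs-◃`.
    descending-local : ∀ {a} ps → length ps ≤ l → Descending ps → All (λ p → 5 ⊢ cost p ◃ size p) ps →
                       Local (a , ps)
    descending-local [] _ _ _ = ◃-base z≤n ℕ.≤-refl
    descending-local (p ∷ ps) len (p≥ ∷ desc) (h ∷ hs) =
      ◃-⊔ {a = suc (suc (cost p))} {suc (costs ps)} 0
        (◃-monoʳ (ℕ.≤-trans (ℕ.m≤m+n (size p) (sizes ps)) (ℕ.n≤1+n _)) (◃-shift 2 h))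
        (costs-◃ 0 1 (size p) ps (s≤s z≤n) z≤n ℕ.≤-refl len (1≤size p) (ℕ.n≤1+n _)
          (All.map (ℕ.≤-trans (ℕ.≤-reflexive (ℕ.+-identityʳ _))) p≥) desc
          (All.map (◃-weaken (ℕ.m≤n+m 5 2)) hs))

    -- Here `p` is where the spine runs on: it is not placed with `ps`, but its weight counts. So
    -- the i-th member of `ps` has at most S / (i + 1) vertices, and already the first division
    -- covers the 4 quantifiers that lead to the median.
    descending-light : ∀ {a S} p ps → length (p ∷ ps) ≤ l → Descending (p ∷ ps) →
                       All (λ p → 5 ⊢ cost p ◃ size p) ps → suc (size p + sizes ps) ≤ S → Light S (a , ps)
    descending-light p ps len (p≥ ∷ desc) hs ≤S = ◃-monoˡ (ℕ.n≤1+n _)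
      (costs-◃ 4 1 (size p) ps ℕ.≤-refl (ℕ.n≤1+n 4) ℕ.≤-refl len (1≤size p) (ℕ.<⇒≤ ≤S)
        (All.map (ℕ.≤-trans (ℕ.≤-reflexive (ℕ.+-identityʳ _))) p≥) desc hs)

    Piece : ℕ → ℕ → List (A × List (Plan A)) → Set
    Piece c S es = es ≡ [] ⊎ ∃ λ p → spine p ≡ es × c ⊢ 4 + cost p ◃ S

    -- Two nested splits join the three parts: `ls` lies under 2 quantifiers, `e` and `rs` under 4.
    assemble : ∀ {c S ls e rs} → Piece c S ls → c ⊢ 4 + costs (proj₂ e) ◃ S → Piece c S rs →
               ∃ λ p → spine p ≡ ls ++ e ∷ rs × c ⊢ cost p ◃ S
    assemble {c} {S} {ls} {e@(a , ps)} {rs} left h right = finish left (start right)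
      where
      start : Piece c S rs → ∃ λ q → spine q ≡ e ∷ rs × c ⊢ 2 + cost q ◃ S
      start (inj₁ refl)           = at a ps , refl , ◃-monoˡ (ℕ.m≤n+m _ 2) h
      start (inj₂ (q , q≡ , hq)) = split (at a ps) q , cong (e ∷_) q≡ , ◃-⊔ 4 h hq
      finish : Piece c S ls → (∃ λ q → spine q ≡ e ∷ rs × c ⊢ 2 + cost q ◃ S) →
               ∃ λ p → spine p ≡ ls ++ e ∷ rs × c ⊢ cost p ◃ S
      finish (inj₁ refl) (q , q≡ , hq)           = q , q≡ , ◃-monoˡ (ℕ.m≤n+m _ 2) hq
      finish (inj₂ (p , p≡ , hp)) (q , q≡ , hq) =
        split p q , cong₂ _++_ p≡ q≡ , ◃-⊔ 2 (◃-monoˡ (ℕ.m≤n+m _ 2) hp) hq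

    half : ∀ {S es} → 2 * total es ≤ S →
           (es ≡ [] ⊎ ∃ λ p → spine p ≡ es × 11 ⊢ cost p ◃ total es) → Piece 5 S es
    half _    (inj₁ es≡)         = inj₁ es≡
    half es≤ (inj₂ (p , p≡ , h)) =
      inj₂ (p , p≡ , ◃-step 6 4 2 ℕ.≤-refl (ℕ.≤-trans (s≤s (s≤s z≤n)) 4≤l) es≤ ℕ.≤-refl h)

    weaken-piece : ∀ {S es} → Piece 5 S es → Piece 11 S es
    weaken-piece (inj₁ es≡)         = inj₁ es≡
    weaken-piece (inj₂ (p , p≡ , h)) = inj₂ (p , p≡ , ◃-weaken (ℕ.m≤m+n 5 6) h)

    -- Only the median needs the constant 11 = 7 + 4; the sides are halved and would do with 5. The
    -- number f bounds the length because the recursion goes to both sides of the median and is not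
    -- structural.
    balance-segment : ∀ f es → length es ≤ f → All Local es →
                      es ≡ [] ⊎ ∃ λ p → spine p ≡ es × 11 ⊢ cost p ◃ total es
    balance-segment f [] _ _ = inj₁ refl
    balance-segment (suc f) es@(_ ∷ _) (s≤s len) hs with weighted-median 0 es (_ , _ , refl) refl z≤n
    ... | ls , e , rs , es≡ , ls≤ , rs≤ =
      inj₂ (subst (λ xs → ∃ λ p → spine p ≡ xs × 11 ⊢ cost p ◃ total es) (≡.sym es≡)
        (assemble (weaken-piece (half ls≤ (balance-segment f ls (bound ls≤len) hls)))
                  (◃-monoʳ e≤ (◃-shift 4 he))
                  (weaken-piece (half rs≤ (balance-segment f rs (bound rs≤len) hrs)))))
      where
      hs′ = subst (All Local) es≡ hs
      hls = Allₚ.++⁻ˡ ls hs′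
      he  = All.head (Allₚ.++⁻ʳ ls hs′)
      hrs = All.tail (Allₚ.++⁻ʳ ls hs′)
      e≤ : weight e ≤ total es
      e≤ = ℕ.≤-trans (ℕ.m≤m+n _ (total rs)) (ℕ.≤-trans (ℕ.m≤n+m _ (total ls))
             (ℕ.≤-reflexive (≡.sym (≡.trans (cong total es≡) (total-++ ls _)))))
      len≡ : length es ≡ suc (length ls + length rs)
      len≡ = ≡.trans (cong length es≡) (≡.trans (length-++ ls) (ℕ.+-suc (length ls) (length rs)))
      bound : ∀ {n} → suc n ≤ length es → n ≤ f
      bound n< = ℕ.≤-trans (ℕ.≤-pred n<) len
      ls≤len : suc (length ls) ≤ length es
      ls≤len = ℕ.≤-trans (s≤s (ℕ.m≤m+n _ _)) (ℕ.≤-reflexive (≡.sym len≡))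
      rs≤len : suc (length rs) ≤ length es
      rs≤len = ℕ.≤-trans (s≤s (ℕ.m≤n+m _ _)) (ℕ.≤-reflexive (≡.sym len≡))

    balance : ∀ es → NonEmpty es → All Local es → All (Light (total es)) es →
              ∃ λ p → spine p ≡ es × 5 ⊢ cost p ◃ total es
    balance es ne hs ts with weighted-median 0 es ne refl z≤n
    ... | ls , e , rs , es≡ , ls≤ , rs≤ =
      subst (λ xs → ∃ λ p → spine p ≡ xs × 5 ⊢ cost p ◃ total es) (≡.sym es≡)
        (assemble (half ls≤ (balance-segment _ ls ℕ.≤-refl (Allₚ.++⁻ˡ ls hs′)))
                  (All.head (Allₚ.++⁻ʳ ls (subst (All (Light (total es))) es≡ ts)))
                  (half rs≤ (balance-segment _ rs ℕ.≤-refl (All.tail (Allₚ.++⁻ʳ ls hs′)))))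
      where hs′ = subst (All Local) es≡ hs

-- Plans of trees

labels-spine : ∀ {A : Set} (p : Plan A) → labels p ≡ concatMap (λ (a , ps) → a ∷ labelss ps) (spine p)
labels-spine (at a ps)   = ≡.sym (++-identityʳ _)
labels-spine (split p q) =
  ≡.trans (cong₂ _++_ (labels-spine p) (labels-spine q)) (≡.sym (concatMap-++ _ (spine p) (spine q)))

chain-∷ : ∀ {A V : Set} {E D : V → V → Set} {Loc : A → V → Set} {a ps es L x y z R} → NonEmpty es →
          E x z → Copy E D Loc (at a ps) L x x [ z ] → Chain E D Loc es [ x ] z y R →
          Chain E D Loc ((a , ps) ∷ es) L x y R
chain-∷ (_ , _ , refl) e g h = _ , e , g , h

length-filter≤sum : ∀ {A : Set} {P : A → Set} (P? : ∀ x → Dec (P x)) (f : A → Bool) → (∀ {x} → P x → T (f x)) →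
                    ∀ xs → length (filter P? xs) ≤ sum (map (λ x → if f x then 1 else 0) xs)
length-filter≤sum P? f P⇒f [] = z≤n
length-filter≤sum P? f P⇒f (x ∷ xs) with P? x | f x | P⇒f {x}
... | yes _  | true  | _ = s≤s (length-filter≤sum P? f P⇒f xs)
... | yes px | false | h = ⊥-elim (h px)
... | no _   | true  | _ = ℕ.m≤n⇒m≤1+n (length-filter≤sum P? f P⇒f xs)
... | no _   | false | _ = length-filter≤sum P? f P⇒f xs

module TreePlan {c N} (G : Graph c N) (acyclic : ¬ Cycle G) (l Q : ℕ) (4≤l : 4 ≤ l)
                (slack : l ^ (8 * Q) ≤ 2 ^ l) (degree≤l : MaxDegreeAtMost G l) where

  open Budget l Q 4≤l slack

  private V = Fin N

  -- A plan of the component of v in G − P, where P holds the parent of v if there is one.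
  record Unfolding (P : List V) (v : V) : Set where
    field
      plan   : Plan V
      last   : V
      chain  : Chain (Adj G) _≢_ _≡_ (spine plan) P v last []
      local  : All Local (spine plan)
      light  : All (Light (size plan)) (spine plan)
      cheap  : 5 ⊢ cost plan ◃ size plan
      root∈  : v ∈ labels plan
      closed : ∀ {u w} → u ∈ labels plan → Adj G u w → w ∈ labels plan ⊎ w ∈ P

  open Unfolding

  Child : V → Set
  Child v = Σ V (Unfolding [ v ])

  planOf : ∀ {v} → Child v → Plan V
  planOf = plan ∘ proj₂

  ∈-children⁺ : ∀ {v} {k : Child v} {ks u} → k ∈ ks → u ∈ labels (planOf k) → u ∈ labelss (map planOf ks)
  ∈-children⁺ (here refl) u∈ = ∈-++⁺ˡ u∈
  ∈-children⁺ {ks = k ∷ _} (there k∈) u∈ = ∈-++⁺ʳ (labels (planOf k)) (∈-children⁺ k∈ u∈)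

  ∈-children⁻ : ∀ {v u} (ks : List (Child v)) → u ∈ labelss (map planOf ks) →
                ∃ λ k → k ∈ ks × u ∈ labels (planOf k)
  ∈-children⁻ (k ∷ ks) u∈ with ∈-++⁻ (labels (planOf k)) u∈
  ... | inj₁ u∈k  = k , here refl , u∈k
  ... | inj₂ u∈ks = let k′ , k′∈ , u∈k′ = ∈-children⁻ ks u∈ks in k′ , there k′∈ , u∈k′

  children-star : ∀ {v} F (ks : List (Child v)) → All (Adj G v ∘ proj₁) ks →
                  All (λ k → All (proj₁ k ≢_) F) ks → AllPairs (λ k k′ → proj₁ k ≢ proj₁ k′) ks →
                  Star (Adj G) _≢_ _≡_ (map planOf ks) F v
  children-star F [] _ _ _ = tt
  children-star F ((y , U) ∷ ks) (e ∷ es) (y∉ ∷ ks∉) (y≢ ∷ distinct) =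
    y , e , y∉ , (last U , chain⇒copy (plan U) (chain U)) ,
    children-star (y ∷ F) ks es (All.zipWith (λ (y≢k , k∉) → (y≢k ∘ ≡.sym) ∷ k∉) (y≢ , ks∉)) distinct

  record Children (P : List V) (v : V) (ks : List (Child v)) : Set where
    field
      adjacent   : All (Adj G v ∘ proj₁) ks
      not-parent : All (λ k → All (proj₁ k ≢_) P) ks
      distinct   : AllPairs (λ k k′ → proj₁ k ≢ proj₁ k′) ks
      few        : length ks ≤ l
      complete   : ∀ {w} → Adj G v w → (∃ λ k → k ∈ ks × proj₁ k ≡ w) ⊎ w ∈ P

  open Children

  unfold-by : ∀ {P v ks} es → NonEmpty es → Children P v ks →
              (∃ λ y → Chain (Adj G) _≢_ _≡_ es P v y []) → All Local es → All (Light (total es)) es →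
              (∀ {u} → u ∈ concatMap (λ (a , ps) → a ∷ labelss ps) es →
                       u ≡ v ⊎ ∃ λ k → k ∈ ks × u ∈ labels (planOf k)) →
              (∀ {u} → (u ≡ v ⊎ ∃ λ k → k ∈ ks × u ∈ labels (planOf k)) →
                       u ∈ concatMap (λ (a , ps) → a ∷ labelss ps) es) →
              Unfolding P v
  unfold-by {P} {v} {ks} es ne C (y , g) loc lig ∈⁻ ∈⁺ with balance es ne loc lig
  ... | p , refl , h = record
    { plan   = p
    ; last   = y
    ; chain  = g
    ; local  = loc
    ; light  = subst (λ s → All (Light s) (spine p)) (total-spine p) lig
    ; cheap  = subst (λ s → 5 ⊢ cost p ◃ s) (total-spine p) h
    ; root∈  = to (inj₁ refl)
    ; closed = λ u∈ → closed′ (from u∈)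
    }
    where
    Placed : V → Set
    Placed u = u ≡ v ⊎ ∃ λ k → k ∈ ks × u ∈ labels (planOf k)
    from : ∀ {u} → u ∈ labels p → Placed u
    from u∈ = ∈⁻ (subst (_ ∈_) (labels-spine p) u∈)
    to : ∀ {u} → Placed u → u ∈ labels p
    to u∈ = subst (_ ∈_) (≡.sym (labels-spine p)) (∈⁺ u∈)
    closed′ : ∀ {u w} → Placed u → Adj G u w → w ∈ labels p ⊎ w ∈ P
    closed′ (inj₁ refl) e with complete C e
    ... | inj₁ (k , k∈ , refl) = inj₁ (to (inj₂ (k , k∈ , root∈ (proj₂ k))))
    ... | inj₂ w∈P             = inj₂ w∈P
    closed′ (inj₂ (k , k∈ , u∈)) e with closed (proj₂ k) u∈ e
    ... | inj₁ w∈          = inj₁ (to (inj₂ (k , k∈ , w∈)))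
    ... | inj₂ (here refl) = inj₁ (to (inj₁ refl))

  -- The first child is the largest, and the spine of `v` runs on into it. The bracketing found for
  -- that child is given up: its chain and the bounds on its entries are reused, and `balance` cuts
  -- the longer spine afresh.
  combine : ∀ {P v} ks → Children P v ks → Descending (map planOf ks) → Unfolding P v
  combine {P} {v} [] C _ =
    unfold-by [ v , [] ] (_ , _ , refl) C
      (v , refl , refl , All.universal (λ _ → []) P , tt)
      (descending-local {a = v} [] z≤n [] [] ∷ []) (◃-base (ℕ.n≤1+n 4) (s≤s z≤n) ∷ [])
      (λ { (here u≡v) → inj₁ u≡v })
      (λ { (inj₁ u≡v) → here u≡v })
  combine {P} {v} ((z , U) ∷ ks) C desc =
    unfold-by ((v , map planOf ks) ∷ spine (plan U)) (_ , _ , refl) C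
      (last U , chain-∷ (spine-nonEmpty (plan U)) (All.head (adjacent C))
        ( refl , refl
        , All.tabulate (λ l∈ → (λ l≡z → All.lookup (All.head (not-parent C)) l∈ (≡.sym l≡z)) ∷ [])
        , children-star (P ++ [ z ]) ks (All.tail (adjacent C))
            (All.zipWith (λ (k∉ , z≢k) → Allₚ.++⁺ k∉ ((z≢k ∘ ≡.sym) ∷ []))
              (All.tail (not-parent C) , AllPairs.head (distinct C)))
            (AllPairs.tail (distinct C)))
        (chain U))
      (descending-local {a = v} (map planOf ks) (ℕ.≤-trans (ℕ.n≤1+n _) few′) (AllPairs.tail desc) cheaps ∷ local U)
      (descending-light {a = v} (plan U) (map planOf ks) few′ desc cheaps (ℕ.≤-reflexive (≡.sym total≡)) ∷
        All.map (◃-monoʳ (ℕ.≤-trans (ℕ.m≤m+n _ _)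
          (ℕ.≤-trans (ℕ.n≤1+n (size (plan U) + sizes (map planOf ks))) (ℕ.≤-reflexive (≡.sym total≡))))) (light U))
      ∈⁻ ∈⁺
    where
    few′ : suc (length (map planOf ks)) ≤ l
    few′ = subst (λ n → suc n ≤ l) (≡.sym (length-map planOf ks)) (few C)
    cheaps : All (λ p → 5 ⊢ cost p ◃ size p) (map planOf ks)
    cheaps = Allₚ.map⁺ (All.universal (λ k → cheap (proj₂ k)) ks)
    total≡ : suc (sizes (map planOf ks)) + total (spine (plan U)) ≡ suc (size (plan U) + sizes (map planOf ks))
    total≡ = cong suc (≡.trans (cong (sizes (map planOf ks) +_) (total-spine (plan U))) (ℕ.+-comm _ (size (plan U))))
    ∈⁻ : ∀ {u} → u ∈ v ∷ labelss (map planOf ks) ++ concatMap (λ (a , ps) → a ∷ labelss ps) (spine (plan U)) →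
         u ≡ v ⊎ ∃ λ k → k ∈ (z , U) ∷ ks × u ∈ labels (planOf k)
    ∈⁻ (here u≡v) = inj₁ u≡v
    ∈⁻ (there u∈) with ∈-++⁻ (labelss (map planOf ks)) u∈
    ... | inj₁ u∈ks = let k , k∈ , u∈k = ∈-children⁻ ks u∈ks in inj₂ (k , there k∈ , u∈k)
    ... | inj₂ u∈U  = inj₂ (_ , here refl , subst (_ ∈_) (≡.sym (labels-spine (plan U))) u∈U)
    ∈⁺ : ∀ {u} → (u ≡ v ⊎ ∃ λ k → k ∈ (z , U) ∷ ks × u ∈ labels (planOf k)) →
         u ∈ v ∷ labelss (map planOf ks) ++ concatMap (λ (a , ps) → a ∷ labelss ps) (spine (plan U))
    ∈⁺ (inj₁ u≡v)                      = here u≡v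
    ∈⁺ (inj₂ (_ , here refl , u∈))     =
      there (∈-++⁺ʳ (labelss (map planOf ks)) (subst (_ ∈_) (labels-spine (plan U)) u∈))
    ∈⁺ (inj₂ (k , there k∈ , u∈)) = there (∈-++⁺ˡ (∈-children⁺ k∈ u∈))

  bySize : V → DecTotalOrder 0ℓ 0ℓ 0ℓ
  bySize v = On.decTotalOrder (Flip.decTotalOrder ℕ.≤-decTotalOrder) (size ∘ planOf {v})

  sort-children : ∀ {P v} ks → Children P v ks → Unfolding P v
  sort-children {P} {v} ks C = combine (sort ks) record
    { adjacent   = All-resp-↭ ↭ks (adjacent C)
    ; not-parent = All-resp-↭ ↭ks (not-parent C)
    ; distinct   = AllPairs-resp-↭ (≡.setoid _) (_∘ ≡.sym) ((λ { refl → id }) , λ { refl → id }) (↭⇒↭ₛ ↭ks) (distinct C)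
    ; few        = subst (_≤ l) (↭-length ↭ks) (few C)
    ; complete   = λ e → Sum.map₁ (λ (k , k∈ , k≡) → k , ∈-resp-↭ ↭ks k∈ , k≡) (complete C e)
    } (AllPairsₚ.map⁺ (Sorted⇒AllPairs (DecTotalOrder.totalOrder (bySize v)) (sort-↗ ks)))
    where
    open import Data.List.Sort (bySize v)
    ↭ks : ks ↭ sort ks
    ↭ks = ↭-sym (sort-↭ ks)

  neighbours : (P : List V) (v : V) → List V
  neighbours P v = filter (λ w → T? (adj G v w) ×-dec All.all? (λ p → ¬? (w Finₚ.≟ p)) P) (allFin N)

  toChildren : ∀ {v us} → All (Unfolding [ v ]) us → List (Child v)
  toChildren []           = []
  toChildren (U ∷ Us) = (_ , U) ∷ toChildren Us

  roots-toChildren : ∀ {v us} (Us : All (Unfolding [ v ]) us) → map proj₁ (toChildren Us) ≡ us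
  roots-toChildren []       = refl
  roots-toChildren (U ∷ Us) = cong (_ ∷_) (roots-toChildren Us)

  unfold-at : ∀ P v → (∀ {u} → Adj G v u → All (u ≢_) P → Unfolding [ v ] u) → Unfolding P v
  unfold-at P v rec = sort-children ks record
    { adjacent   = Allₚ.map⁻ (subst (All (Adj G v)) (≡.sym roots≡) (All.tabulate (proj₁ ∘ is-neighbour)))
    ; not-parent = Allₚ.map⁻ (subst (All (λ w → All (w ≢_) P)) (≡.sym roots≡) (All.tabulate (proj₂ ∘ is-neighbour)))
    ; distinct   = AllPairsₚ.map⁻ (subst Unique (≡.sym roots≡) (AllPairsₚ.filter⁺ _ (allFin⁺ N)))
    ; few        = ℕ.≤-trans (ℕ.≤-reflexive (≡.trans (≡.sym (length-map proj₁ ks)) (cong length roots≡)))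
                     (ℕ.≤-trans (length-filter≤sum _ (adj G v) proj₁ (allFin N)) (degree≤l v))
    ; complete   = complete′
    }
    where
    is-neighbour : ∀ {w} → w ∈ neighbours P v → Adj G v w × All (w ≢_) P
    is-neighbour w∈ = proj₂ (∈-filter⁻ _ {xs = allFin N} w∈)
    Us : All (Unfolding [ v ]) (neighbours P v)
    Us = All.tabulate λ w∈ → uncurry rec (is-neighbour w∈)
    ks     = toChildren Us
    roots≡ = roots-toChildren Us
    complete′ : ∀ {w} → Adj G v w → (∃ λ k → k ∈ ks × proj₁ k ≡ w) ⊎ w ∈ P
    complete′ {w} e with Any.any? (w Finₚ.≟_) P
    ... | yes w∈P = inj₂ w∈P
    ... | no w∉P  =
      let k , k∈ , w≡ = ∈-map⁻ proj₁ (subst (w ∈_) (≡.sym roots≡)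
                          (∈-filter⁺ _ (∈-allFin w) (e , Allₚ.¬Any⇒All¬ P w∉P)))
      in inj₁ (k , k∈ , ≡.sym w≡)

  -- The fuel f never runs out, since a walk in a tree has at most N vertices.
  unfold : ∀ f {p v t r} (w : NB (Adj G) _≢_ v p t r) → N < f + suc (suc (length (beyond w))) → Unfolding [ p ] v
  unfold zero w fuel = contradiction (unique-length (walk-unique G acyclic w)) (ℕ.<⇒≱ fuel)
  unfold (suc f) {p} {v} w fuel = unfold-at [ p ] v λ { e (u≢p ∷ []) →
    unfold f (step (adj-sym G e) u≢p w) (subst (N <_) (≡.sym (ℕ.+-suc f _)) fuel) }

  tree-plan : ∀ r → Unfolding [] r
  tree-plan r = unfold-at [] r λ e _ → unfold N (one (adj-sym G e)) (ℕ.m<m+n N (s≤s z≤n))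

  spans : ∀ {r} (U : Unfolding [] r) → Connected G → ∀ v → v ∈ labels (plan U)
  spans U connected v = along (connected _ v) (root∈ U)
    where
    along : ∀ {u} → Path G u v → u ∈ labels (plan U) → v ∈ labels (plan U)
    along here       u∈ = u∈
    along (step e π) u∈ with closed U u∈ e
    ... | inj₁ w∈ = along π w∈

-- The defining sentence

colourF : ∀ {c N} → Graph c N → ∀ {k} → Fin N → Fin k → Fml c k
colourF {c} G a x = conj x (map (λ j → if color G a j then col j x else ncol j x) (allFin c))

SameColour : ∀ {c M N} → Graph c N → Graph c M → Fin N → Fin M → Set
SameColour G H a v = ∀ j → color H v j ≡ color G a j

module _ {c N} (G : Graph c N) where

  private
    literal : ∀ {k} → Fin N → Fin k → Fin c → Fml c k
    literal a x j = if color G a j then col j x else ncol j x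

    literal-qf : ∀ {k} a (x : Fin k) j → QuantifierFree (literal a x j)
    literal-qf a x j with color G a j
    ... | true  = refl , tt
    ... | false = refl , tt

  colourF-qf : ∀ {k} a (x : Fin k) → QuantifierFree (colourF G a x)
  colourF-qf a x = conj-quantifierFree x (Allₚ.map⁺ (All.universal (literal-qf a x) (allFin c)))

  module _ {M} (H : Graph c M) {k} (ρ : Fin k → Fin M) (a : Fin N) (x : Fin k) where

    private
      literal-sound : ∀ j → Sat H ρ (literal a x j) → color H (ρ x) j ≡ color G a j
      literal-sound j s with color G a j | color H (ρ x) j in e
      ... | true  | true  = refl
      ... | false | false = refl
      ... | true  | false = ⊥-elim (subst T e s)
      ... | false | true  = ⊥-elim (s (subst T (≡.sym e) tt))

      literal-complete : ∀ j → color H (ρ x) j ≡ color G a j → Sat H ρ (literal a x j)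
      literal-complete j e with color G a j
      ... | true  = subst T (≡.sym e) tt
      ... | false = subst T e

    colourF-sound : Sat H ρ (colourF G a x) → SameColour G H a (ρ x)
    colourF-sound s j = literal-sound j (All.lookup (Allₚ.map⁻ (conj-sound H ρ x _ s)) (∈-allFin j))

    colourF-complete : SameColour G H a (ρ x) → Sat H ρ (colourF G a x)
    colourF-complete same = conj-complete H ρ x (Allₚ.map⁺ (All.universal (λ j → literal-complete j (same j)) (allFin c)))

module _ {A B : Set} {R : A → B → Set} where

  pointwise-∈ˡ : ∀ {xs ys x} → Pointwise R xs ys → x ∈ xs → ∃ λ y → y ∈ ys × R x y
  pointwise-∈ˡ (r ∷ _)  (here refl) = _ , here refl , r
  pointwise-∈ˡ (_ ∷ rs) (there x∈)  = let y , y∈ , r = pointwise-∈ˡ rs x∈ in y , there y∈ , r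

  pointwise-∈ʳ : ∀ {xs ys y} → Pointwise R xs ys → y ∈ ys → ∃ λ x → R x y
  pointwise-∈ʳ (r ∷ _)  (here refl) = _ , r
  pointwise-∈ʳ (_ ∷ rs) (there y∈)  = pointwise-∈ʳ rs y∈

allPairs-∈ : ∀ {A : Set} {R : A → A → Set} {xs x y} → AllPairs R xs → x ∈ xs → y ∈ xs → x ≡ y ⊎ R x y ⊎ R y x
allPairs-∈ (_ ∷ _)  (here refl) (here refl) = inj₁ refl
allPairs-∈ (rs ∷ _) (here refl) (there y∈)  = inj₂ (inj₁ (All.lookup rs y∈))
allPairs-∈ (rs ∷ _) (there x∈)  (here refl) = inj₂ (inj₂ (All.lookup rs x∈))
allPairs-∈ (_ ∷ ps) (there x∈)  (there y∈)  = allPairs-∈ ps x∈ y∈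

T-antisym : ∀ {a b} → (T a → T b) → (T b → T a) → a ≡ b
T-antisym {true}  {true}  _ _ = refl
T-antisym {false} {false} _ _ = refl
T-antisym {true}  {false} f _ = ⊥-elim (f tt)
T-antisym {false} {true}  _ g = ⊥-elim (g tt)

module _ {A : Set} {c N} (G : Graph c N) {Loc : A → Fin N → Set} where

  length-vertices : ∀ p {L x y R} (g : Copy (Adj G) _≢_ Loc p L x y R) → length (vertices p g) ≡ size p
  length-vertices p g = ≡.trans (≡.sym (Pointwise-length (labels-vertices p g))) (length-labels p)

  vertices-unique : ¬ Cycle G → ∀ p {x y} (g : Copy (Adj G) _≢_ Loc p [] x y []) → Unique (vertices p g)
  vertices-unique acyclic p g =
    AllPairs.map (λ (_ , _ , w) → walk-ends-differ G acyclic w)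
      (all-joined (adj-sym G) (λ u≢v → u≢v ∘ ≡.sym) p g [] [])

-- If G and H are acyclic, then two vertices of the product joined by a
-- non-backtracking walk differ in both coordinates, and they are adjacent in
-- one coordinate iff they are adjacent in the other one. So a plan copied onto
-- all of G and onto all of H yields an isomorphism.
module _ {c M N} {H : Graph c M} {G : Graph c N} (H-acyclic : ¬ Cycle H) (G-acyclic : ¬ Cycle G)
         (ps : List (Fin N × Fin M))
         (joined : AllPairs (λ x y → ∃₂ λ s t → NB (Adj G ⊗ Adj H) (_≢_ ⊗ _≢_) x s t y) ps)
         (total₁ : ∀ u → ∃ λ w → (u , w) ∈ ps) (total₂ : ∀ w → ∃ λ u → (u , w) ∈ ps)
         (colours : ∀ {u w} → (u , w) ∈ ps → SameColour G H u w) where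

  private
    Joined× : Fin N × Fin M → Fin N × Fin M → Set
    Joined× x y = ∃₂ λ s t → NB (Adj G ⊗ Adj H) (_≢_ ⊗ _≢_) x s t y

    differ₁ : ∀ {x y} → Joined× x y → proj₁ x ≢ proj₁ y
    differ₁ (_ , _ , w) = walk-ends-differ G G-acyclic (mapNB proj₁ proj₁ proj₁ w)

    differ₂ : ∀ {x y} → Joined× x y → proj₂ x ≢ proj₂ y
    differ₂ (_ , _ , w) = walk-ends-differ H H-acyclic (mapNB proj₂ proj₂ proj₂ w)

    unique₁ : ∀ {u w u′ w′} → (u , w) ∈ ps → (u′ , w′) ∈ ps → u ≡ u′ → w ≡ w′
    unique₁ x∈ y∈ u≡ with allPairs-∈ {R = Joined×} joined x∈ y∈
    ... | inj₁ refl     = refl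
    ... | inj₂ (inj₁ j) = contradiction u≡ (differ₁ j)
    ... | inj₂ (inj₂ j) = contradiction (≡.sym u≡) (differ₁ j)

    unique₂ : ∀ {u w u′ w′} → (u , w) ∈ ps → (u′ , w′) ∈ ps → w ≡ w′ → u ≡ u′
    unique₂ x∈ y∈ w≡ with allPairs-∈ {R = Joined×} joined x∈ y∈
    ... | inj₁ refl     = refl
    ... | inj₂ (inj₁ j) = contradiction w≡ (differ₂ j)
    ... | inj₂ (inj₂ j) = contradiction (≡.sym w≡) (differ₂ j)

    G⇒H : ∀ {x y} → Joined× x y → Adj G (proj₁ x) (proj₁ y) → Adj H (proj₂ x) (proj₂ y)
    G⇒H (_ , _ , one (_ , e)) _ = e
    G⇒H (_ , _ , step (e , _) (d , _) w) f =
      contradiction f (no-chord G G-acyclic e d (mapNB proj₁ proj₁ proj₁ w))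

    H⇒G : ∀ {x y} → Joined× x y → Adj H (proj₂ x) (proj₂ y) → Adj G (proj₁ x) (proj₁ y)
    H⇒G (_ , _ , one (e , _)) _ = e
    H⇒G (_ , _ , step (_ , e) (_ , d) w) f =
      contradiction f (no-chord H H-acyclic e d (mapNB proj₂ proj₂ proj₂ w))

    edges : ∀ {u w u′ w′} → (u , w) ∈ ps → (u′ , w′) ∈ ps → adj H w w′ ≡ adj G u u′
    edges {u} {w} x∈ y∈ with allPairs-∈ {R = Joined×} joined x∈ y∈
    ... | inj₁ refl     = ≡.trans (irr H w) (≡.sym (irr G u))
    ... | inj₂ (inj₁ j) = T-antisym (H⇒G j) (G⇒H j)
    ... | inj₂ (inj₂ j) = T-antisym (adj-sym G ∘ H⇒G j ∘ adj-sym H) (adj-sym H ∘ G⇒H j ∘ adj-sym G)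

  product-iso : Iso H G
  product-iso = record
    { bij      = mk⤖ {to = λ w → proj₁ (total₂ w)}
                   ( (λ {w} {w′} → unique₁ (proj₂ (total₂ w)) (proj₂ (total₂ w′)))
                   , λ u → proj₁ (total₁ u) , λ { refl → unique₂ (proj₂ (total₂ _)) (proj₂ (total₁ u)) refl })
    ; pres-adj = λ w w′ → edges (proj₂ (total₂ w)) (proj₂ (total₂ w′))
    ; pres-col = λ w → colours (proj₂ (total₂ w))
    }

module Sentences {c N} (G : Graph c N) (p : Plan (Fin N)) (q : Plan ⊤) where

  trueF : ∀ {k} → ⊤ → Fin k → Fml c k
  trueF _ x = eq x x

  -- Variables 1 and 0 are the two ends of the spine; in `missBody`, variable 2 is the vertex to be
  -- missed.
  copyBody : Fml c 2
  copyBody = copyF (colourF G) p [] (suc zero) zero [] []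

  missBody : Fml c 3
  missBody = copyF (colourF G) p [] (suc zero) zero [] [ suc (suc zero) ]

  pathBody : Fml c 2
  pathBody = copyF trueF q [] (suc zero) zero [] []

  defining : Sentence c
  defining = and (ex (ex copyBody)) (and (neg (ex (ex (ex missBody)))) (neg (ex (ex pathBody))))

  alt-defining : alt defining ≡ 0
  alt-defining = cong₂ _⊔_
    (altUnder-existential copyBody (copyF-existential (colourF G) (colourF-qf G) p _ _ _ _ _))
    (cong₂ _⊔_
      (altUnder-neg missBody (copyF-existential (colourF G) (colourF-qf G) p _ _ _ _ _))
      (altUnder-neg pathBody (copyF-existential trueF (λ _ _ → refl , tt) q _ _ _ _ _)))

  qd-defining : qd defining ≡ (2 + cost p) ⊔ ((3 + cost p) ⊔ (2 + cost q))
  qd-defining = cong₂ _⊔_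
    (cong (2 +_) (qd-copyF (colourF G) (colourF-qf G) p _ _ _ _ _))
    (cong₂ _⊔_
      (cong (3 +_) (≡.trans (qd-neg missBody) (qd-copyF (colourF G) (colourF-qf G) p _ _ _ _ _)))
      (cong (2 +_) (≡.trans (qd-neg pathBody) (qd-copyF trueF (λ _ _ → refl , tt) q _ _ _ _ _))))

  ColouredCopy : ∀ {M} → Graph c M → List (Fin M) → Set
  ColouredCopy {M} H W = ∃₂ λ x y →
    Copy (Adj H) _≢_ (Avoiding (colourF G) H (SameColour G H) W) p [] x y []

  PathCopy : ∀ {M} → Graph c M → Set
  PathCopy H = ∃₂ λ x y → Copy (Adj H) _≢_ (Avoiding trueF H (λ _ _ → ⊤) []) q [] x y []

  module _ {M} (H : Graph c M) where

    copy-sound : H ⊨ ex (ex copyBody) → ColouredCopy H []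
    copy-sound (x , y , s) = x , y , copyF-sound (colourF G) H _ (colourF-sound G H) _ p refl refl refl s

    copy-complete : ColouredCopy H [] → H ⊨ ex (ex copyBody)
    copy-complete (x , y , g) = x , y , copyF-complete (colourF G) H _ (colourF-complete G H) _ p refl refl refl g

    miss-sound : H ⊨ ex (ex (ex missBody)) → ∃ λ w → ColouredCopy H [ w ]
    miss-sound (w , x , y , s) = w , x , y , copyF-sound (colourF G) H _ (colourF-sound G H) _ p refl refl refl s

    miss-complete : (∃ λ w → ColouredCopy H [ w ]) → H ⊨ ex (ex (ex missBody))
    miss-complete (w , x , y , g) = w , x , y , copyF-complete (colourF G) H _ (colourF-complete G H) _ p refl refl refl g

    path-sound : H ⊨ ex (ex pathBody) → PathCopy H
    path-sound (x , y , s) = x , y , copyF-sound trueF H _ (λ _ _ _ _ → tt) _ q refl refl refl s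

    path-complete : PathCopy H → H ⊨ ex (ex pathBody)
    path-complete (x , y , g) = x , y , copyF-complete trueF H _ (λ _ _ _ _ → refl) _ q refl refl refl g

  module _ (acyclic : ¬ Cycle G) {r last} (T-copy : Copy (Adj G) _≢_ _≡_ p [] r last [])
           (spans : ∀ v → v ∈ labels p) (q-spine : spine q ≡ pathSpine N) (q-size : size q ≡ suc N) where

    holds : G ⊨ defining
    holds = copy-complete G (r , last ,
              mapCopy id id id (λ { refl _ → (λ _ → refl) , [] }) p T-copy (All.universal (λ _ → tt) _))
          , refute (ex (ex (ex missBody))) no-miss , refute (ex (ex pathBody)) no-path
      where
      refute : ∀ φ → ¬ G ⊨ φ → G ⊨ neg φ
      refute φ ¬s with excluded-middle G noVars φ
      ... | inj₁ s = contradiction s ¬s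
      ... | inj₂ s = s
      no-miss : ¬ G ⊨ ex (ex (ex missBody))
      no-miss s with miss-sound G s
      -- A copy in G is injective and has as many vertices as the plan has labels, hence at least N.
      -- A missed vertex would be one too many.
      ... | w , x , y , g = contradiction
        (unique-length {xs = w ∷ vertices p g} (All.tabulate avoided ∷ vertices-unique G acyclic p g))
        (ℕ.<⇒≱ (s≤s (ℕ.≤-trans (covering-length spans)
          (ℕ.≤-reflexive (≡.trans (length-labels p) (≡.sym (length-vertices G p g)))))))
        where
        avoided : ∀ {v} → v ∈ vertices p g → w ≢ v
        avoided v∈ w≡v with pointwise-∈ʳ (labels-vertices p g) v∈
        ... | _ , _ , v≢w ∷ [] = v≢w (≡.sym w≡v)
      no-path : ¬ G ⊨ ex (ex pathBody)
      no-path s with path-sound G s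
      ... | x , y , g = contradiction (unique-length (vertices-unique G acyclic q g))
        (ℕ.<⇒≱ (ℕ.≤-reflexive (≡.sym (≡.trans (length-vertices G q g) q-size))))

    defines-iso : ∀ {M} (H : Graph c M) → H ⊨ defining → Iso H G
    defines-iso {M} H (s , ¬miss , ¬path) with copy-sound H s
    ... | x , y , h = product-iso H-acyclic acyclic ps
                        (all-joined (λ (e , e′) → adj-sym G e , adj-sym H e′)
                                    (λ (d , d′) → d ∘ ≡.sym , d′ ∘ ≡.sym) p g [] [])
                        total₁ total₂ colours
      where
      H-acyclic : ¬ Cycle H
      H-acyclic C = non-contradiction H noVars (ex (ex pathBody)) ¬path (path-complete H
        (let y , g = cycle-chain H C (λ _ → tt , []) N zero [] [] in
         _ , y , chain⇒copy q (subst (λ es → Chain (Adj H) _≢_ _ es [] (Cycle.vtx C zero) y []) (≡.sym q-spine) g)))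
      g  = zipCopy p [] [] T-copy h
      ps = vertices p g
      total₁ : ∀ u → ∃ λ w → (u , w) ∈ ps
      total₁ u with pointwise-∈ˡ (labels-vertices p g) (spans u)
      ... | (_ , w) , x∈ , refl , _ = w , x∈
      total₂ : ∀ w → ∃ λ u → (u , w) ∈ ps
      total₂ w with Any.any? (λ x → proj₂ x Finₚ.≟ w) ps
      ... | yes w∈ = let x , x∈ , w≡ = find w∈ in proj₁ x , subst (λ w → (proj₁ x , w) ∈ ps) w≡ x∈
      -- If w is no second coordinate, then the projection of `g` to H is a copy that misses w.
      ... | no w∉  = contradiction
        (miss-complete H (w , x , y ,
          mapCopy proj₂ proj₂ proj₂ (λ (_ , l , _) x≢w → l , x≢w ∷ []) p g (Allₚ.¬Any⇒All¬ ps w∉)))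
        (non-contradiction H noVars (ex (ex (ex missBody))) ¬miss)
      colours : ∀ {u w} → (u , w) ∈ ps → SameColour G H u w
      colours x∈ with pointwise-∈ʳ (labels-vertices p g) x∈
      ... | _ , refl , same , _ = same

total-pathSpine : ∀ n → total (pathSpine n) ≡ suc n
total-pathSpine zero    = refl
total-pathSpine (suc n) = cong suc (total-pathSpine n)

-- The sentence of a single tree, its depth, and the choice of parameters

module _ {c N l Q} (G : Graph c N) (connected : Connected G) (acyclic : ¬ Cycle G) (4≤l : 4 ≤ l)
         (slack : l ^ (8 * Q) ≤ 2 ^ l) (degree≤l : MaxDegreeAtMost G l) where

  open Budget l Q 4≤l slack
  open TreePlan G acyclic l Q 4≤l slack degree≤l

  unfolding⇒sentence : ∀ {n r} → Unfolding [] r → 2 ^ (2 + Q) ≤ n → N ≤ n →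
    Σ (Sentence c) λ φ → Defines φ G × alt φ ≡ 0 × l ^ (Q * qd φ) ≤ n ^ ((2 + Q) * l)
  unfolding⇒sentence {n} {r} U 2^≤n N≤n =
    defining ,
    (holds acyclic copy (spans U connected) q≡ size-q ,
     λ H ≇ s → ≇ (defines-iso acyclic copy (spans U connected) q≡ size-q H s)) ,
    alt-defining , depth
    where
    open Unfolding U using (plan; chain; cheap)
    path = balance (pathSpine N) (_ , _ , refl)
             (Allₚ.replicate⁺ (suc N) (◃-base z≤n (s≤s z≤n)))
             (Allₚ.replicate⁺ (suc N) (◃-base (ℕ.n≤1+n 4) (s≤s z≤n)))
    q  = proj₁ path
    q≡ = proj₁ (proj₂ path)
    size-q : size q ≡ suc N
    size-q = ≡.trans (≡.sym (total-spine q)) (≡.trans (cong total q≡) (total-pathSpine N))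
    open Sentences G plan q
    copy = chain⇒copy plan chain
    size≤ : size plan ≤ N
    size≤ = ℕ.≤-trans (ℕ.≤-reflexive (≡.sym (length-vertices G plan copy)))
              (unique-length (vertices-unique G acyclic plan copy))
    N≤2n : N ≤ 2 * n
    N≤2n = ℕ.≤-trans N≤n (ℕ.m≤m+n n _)
    sN≤2n : suc N ≤ 2 * n
    sN≤2n = ℕ.+-mono-≤ (ℕ.≤-trans (ℕ.m^n>0 2 (2 + Q)) 2^≤n) (ℕ.≤-trans N≤n (ℕ.m≤m+n n 0))
    miss-◃ : 8 ⊢ 3 + cost plan ◃ (2 * n)
    miss-◃ = ◃-monoʳ (ℕ.≤-trans size≤ N≤2n) (◃-shift 3 cheap)
    path-◃ : 8 ⊢ 2 + cost q ◃ (2 * n)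
    path-◃ = ◃-weaken (ℕ.n≤1+n 7) (◃-monoʳ (ℕ.≤-trans (ℕ.≤-reflexive (total-pathSpine N)) sN≤2n)
               (◃-shift 2 (proj₂ (proj₂ path))))
    depth : l ^ (Q * qd defining) ≤ n ^ ((2 + Q) * l)
    depth = ◃-conclude 2^≤n (subst (λ d → 8 ⊢ d ◃ (2 * n)) (≡.sym qd-defining)
      (◃-⊔ 0 (◃-monoˡ (ℕ.n≤1+n (2 + cost plan)) miss-◃) (◃-⊔ {a = 3 + cost plan} 0 miss-◃ path-◃)))

tree-sentence : ∀ {c N n l Q} → 4 ≤ l → l ^ (8 * Q) ≤ 2 ^ l → 2 ^ (2 + Q) ≤ n →
  (G : Graph c N) → IsTree G → N ≤ n → MaxDegreeAtMost G l →
  Σ (Sentence c) λ φ → Defines φ G × alt φ ≡ 0 × l ^ (Q * qd φ) ≤ n ^ ((2 + Q) * l)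
tree-sentence {N = suc _} {l = l} {Q} 4≤l slack 2^≤n G (_ , connected , acyclic) N≤n degree≤l =
  unfolding⇒sentence G connected acyclic 4≤l slack degree≤l
    (TreePlan.tree-plan G acyclic l Q 4≤l slack degree≤l zero) 2^≤n N≤n

square-cancel-≤ : ∀ {a b} → a ^ 2 ≤ b ^ 2 → a ≤ b
square-cancel-≤ h = ℕ.≮⇒≥ λ b<a → ℕ.<⇒≱ (ℕ.^-monoˡ-< 2 b<a) h

theorem8 : (l : ℕ → ℕ)
    → (∀ L → ∃ λ n₀ → ∀ n → n₀ ≤ n → L ≤ l n)
    → (∀ K → ∃ λ n₀ → ∀ n → n₀ ≤ n → l n ^ K ≤ n)
    → ∀ (p q : ℕ) → ∃ λ n₀ → ∀ n → n₀ ≤ n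
    → ∀ (c N : ℕ) (G : Graph c N) → IsTree G → N ≤ n → MaxDegreeAtMost G (l n)
    → Σ (Sentence c) λ φ → Defines φ G × alt φ ≡ 0
    × l n ^ (suc q * qd φ) ≤ n ^ ((suc q + suc p) * l n)
theorem8 l l→∞ _ p q = n₁ + 2 ^ (2 + Q) , λ n n₀≤n c N G tree N≤n degree≤l →
  let l-large = proj₂ (l→∞ (4 + l₀)) n (ℕ.≤-trans (ℕ.m≤m+n n₁ _) n₀≤n)
      2^≤n    = ℕ.≤-trans (ℕ.m≤n+m (2 ^ (2 + Q)) n₁) n₀≤n
      φ , defines , alt≡0 , depth = tree-sentence {Q = Q}
        (ℕ.≤-trans (ℕ.m≤m+n 4 l₀) l-large)
        (proj₂ (power≤exponential (8 * Q)) (l n) (ℕ.≤-trans (ℕ.m≤n+m l₀ 4) l-large))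
        2^≤n G tree N≤n degree≤l
  in φ , defines , alt≡0 , halve n (l n) (qd φ) (ℕ.≤-trans (ℕ.m^n>0 2 (2 + Q)) 2^≤n) depth
  where
  -- One 1/Q is lost in the budget inequality and another in `◃-conclude`; the resulting factor 1 +
  -- 2/Q equals 1 + 1/(q + 1), which is at most the required 1 + (p + 1)/(q + 1). The doubled
  -- exponents are removed by a square root.
  Q  = suc q * 2
  l₀ = proj₁ (power≤exponential (8 * Q))
  n₁ = proj₁ (l→∞ (4 + l₀))
  halve : ∀ n l d → 1 ≤ n → l ^ (Q * d) ≤ n ^ ((2 + Q) * l) → l ^ (suc q * d) ≤ n ^ ((suc q + suc p) * l)
  halve n l d 1≤n h = ℕ.≤-trans
    (square-cancel-≤ (begin
      (l ^ (suc q * d)) ^ 2           ≡⟨ ℕ.^-*-assoc l (suc q * d) 2 ⟩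
      l ^ (suc q * d * 2)             ≡⟨ cong (l ^_) (swap (suc q) d) ⟩
      l ^ (Q * d)                     ≤⟨ h ⟩
      n ^ ((2 + Q) * l)               ≡⟨ cong (n ^_) (swap (2 + q) l) ⟨
      n ^ ((2 + q) * l * 2)           ≡⟨ ℕ.^-*-assoc n ((2 + q) * l) 2 ⟨
      (n ^ ((2 + q) * l)) ^ 2         ∎))
    (ℕ.^-monoʳ-≤ n (ℕ.*-monoˡ-≤ l (s≤s (ℕ.≤-trans (ℕ.≤-reflexive (ℕ.+-comm 1 q)) (ℕ.+-monoʳ-≤ q (s≤s z≤n))))))
    where
    open ℕ.≤-Reasoning
    swap : ∀ a b → a * b * 2 ≡ a * 2 * b
    swap = solve-∀
    instance
      n≢0 : NonZero n
      n≢0 = >-nonZero 1≤n
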